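{- Let $n$ be a positive integer and let $D_1\subseteq[n-1]$ and $D_2\subseteq[n-1]$. Then (1) $$\sum_{\{\pi\in S_n\,:\,\mathrm{Des}_S(\pi^{ -1})\subseteq D_1,\ \mathrm{Del}_S(\pi^{ -1})\subseteq D_2\}} q^{\mathrm{rmaj}_{S_n}(\pi)}=\sum_{\{\pi\in S_n\,:\,\mathrm{Des}_S(\pi^{ -1})\subseteq D_1,\ \mathrm{Del}_S(\pi^{ -1})\subseteq D_2\}} q^{\ell_S(\pi)},$$ and (2) $$\sum_{\{\sigma\in A_{n+1}\,:\,\mathrm{Des}_A(\sigma^{ -1})\subseteq D_1,\ \mathrm{Del}_A(\sigma^{ -1})\subseteq D_2\}} q^{\mathrm{rmaj}_{A_{n+1}}(\sigma)}=\sum_{\{\sigma\in A_{n+1}\,:\,\mathrm{Des}_A(\sigma^{ -1})\subseteq D_1,\ \mathrm{Del}_A(\sigma^{ -1})\subseteq D_2\}} q^{\ell_A(\sigma)}.$$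
   Context: $[m]=\{1,\dots,m\}$. Permutations are written in one-line notation $\pi=[\pi(1),\dots,\pi(n)]$ and multiplied as functions: $(\sigma\tau)(k)=\sigma(\tau(k))$; $s_i=(i,i+1)$. Symmetric group statistics: $\mathrm{Des}_S(\pi)=\{i\in[n-1]:\pi(i)>\pi(i+1)\}$; $\mathrm{rmaj}_{S_n}(\pi)=\sum_{i\in\mathrm{Des}_S(\pi)}(n-i)$; $\ell_S(\pi)$ is the number of inversions of $\pi$ (pairs $i<j$ with $\pi(i)>\pi(j)$); $\mathrm{Del}_S(w)=\{1<i\le n:\ w(i)<w(j)\text{ for all }j<i\}$ (left-to-right minima other than position 1). Alternating group: in $S_{n+1}$ put $a_i=s_1s_{i+1}=(1,2)(i+1,i+2)$ for $1\le i\le n-1$. For $1\le j\le n-1$ let $R^A_j=\{1,\ a_j,\ a_ja_{j-1},\ \dots,\ a_j\cdots a_2,\ a_j\cdots a_2a_1,\ a_j\cdots a_2a_1^{ -1}\}$ (so $R^A_1=\{1,a_1,a_1^{ -1}\}$), each element regarded as the displayed word. Every $v\in A_{n+1}$ has a unique factorization $v=v_1\cdots v_{n-1}$ with $v_j\in R^A_j$ (the $A$ canonical presentation); $\ell_A(v)$ is the total number of letters $a_i^{\pm1}$ in this word. $\mathrm{Des}_A(\sigma)=\{1\le i\le n-1:\ \ell_A(\sigma)\ge\ell_A(\sigma a_i)\}$ and $\mathrm{rmaj}_{A_{n+1}}(\sigma)=\sum_{i\in\mathrm{Des}_A(\sigma)}(n-i)$. For $w\in A_{n+1}$ (one-line notation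 $[b_1,\dots,b_{n+1}]$), $\mathrm{Del}_A(w)$ is the set of positions $i$ with $3\le i\le n+1$ such that $|\{j<i: b_j<b_i\}|\le 1$. -}

module Defs where

open import Data.Bool using (Bool; true; false; if_then_else_; _∧_; _∨_; not)
open import Data.Nat using (ℕ; zero; suc; _+_; _∸_; _≤_; _≡ᵇ_; _<ᵇ_; _≤ᵇ_; _%_)
open import Data.List using (List; []; _∷_; _++_; map; length; sum; concatMap; upTo; filterᵇ; all; any)
open import Data.List.Properties using (≡-dec)
open import Data.Nat.Properties using (_≟_)
open import Data.Product using (_×_; _,_)
open import Relation.Nullary.Decidable using (⌊_⌋)

-- Permutations of [m] are represented in one-line notation as lists
-- [π(1), …, π(m)] of natural numbers.

range : ℕ → List ℕ
range m = map suc (upTo m)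

interval : ℕ → ℕ → List ℕ
interval a b = map (λ t → a + t) (upTo (suc b ∸ a))

-- 1-based lookup (default 0)
at : List ℕ → ℕ → ℕ
at []       _             = 0
at (x ∷ xs) zero          = 0
at (x ∷ xs) (suc zero)    = x
at (x ∷ xs) (suc (suc k)) = at xs (suc k)

memᵇ : ℕ → List ℕ → Bool
memᵇ i D = any (λ d → i ≡ᵇ d) D

listEqᵇ : List ℕ → List ℕ → Bool
listEqᵇ xs ys = ⌊ ≡-dec _≟_ xs ys ⌋

count : {A : Set} → (A → Bool) → List A → ℕ
count p xs = length (filterᵇ p xs)

compose : List ℕ → List ℕ → List ℕ
compose σ τ = map (at σ) τ

-- first position (1-based) of j in π (default 0)
position : ℕ → List ℕ → ℕ
position j []       = 0
position j (x ∷ xs) = if j ≡ᵇ x then 1 else (if position j xs ≡ᵇ 0 then 0 else suc (position j xs))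

inverse : List ℕ → List ℕ
inverse π = map (λ j → position j π) (range (length π))

allWords : ℕ → List ℕ → List (List ℕ)
allWords zero    xs = [] ∷ []
allWords (suc m) xs = concatMap (λ x → map (x ∷_) (allWords m xs)) xs

distinctᵇ : List ℕ → Bool
distinctᵇ w = all (λ j → all (λ i → not (at w i ≡ᵇ at w j)) (interval 1 (j ∸ 1))) (range (length w))

Sym : ℕ → List (List ℕ)
Sym m = filterᵇ distinctᵇ (allWords m (range m))

lenS : List ℕ → ℕ
lenS π = count (λ ij → at π (Data.Product.proj₂ ij) <ᵇ at π (Data.Product.proj₁ ij))
               (concatMap (λ i → map (λ j → (i , j)) (interval (suc i) (length π))) (range (length π)))

isDesS : List ℕ → ℕ → Bool
isDesS π i = at π (suc i) <ᵇ at π i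

rmajS : List ℕ → ℕ
rmajS π = sum (map (λ i → length π ∸ i) (filterᵇ (isDesS π) (range (length π ∸ 1))))

desSSubᵇ : List ℕ → List ℕ → Bool
desSSubᵇ π D = all (λ i → not (isDesS π i) ∨ memᵇ i D) (range (length π ∸ 1))

isDelS : List ℕ → ℕ → Bool
isDelS w i = all (λ j → at w i <ᵇ at w j) (interval 1 (i ∸ 1))

delSSubᵇ : List ℕ → List ℕ → Bool
delSSubᵇ w D = all (λ i → not (isDelS w i) ∨ memᵇ i D) (interval 2 (length w))

Alt : ℕ → List (List ℕ)
Alt m = filterᵇ (λ π → lenS π % 2 ≡ᵇ 0) (Sym m)

idPerm : ℕ → List ℕ
idPerm m = range m

sPerm : ℕ → ℕ → List ℕ
sPerm m j = map (λ k → if k ≡ᵇ j then suc j else (if k ≡ᵇ suc j then j else k)) (range m)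

aGen : ℕ → ℕ → List ℕ
aGen n i = compose (sPerm (suc n) 1) (sPerm (suc n) (suc i))

-- a letter a_i^{±1}: (i , false) means a_i, (i , true) means a_i^{-1}
Letter : Set
Letter = ℕ × Bool

letterPerm : ℕ → Letter → List ℕ
letterPerm n (i , false) = aGen n i
letterPerm n (i , true)  = inverse (aGen n i)

evalWord : ℕ → List Letter → List ℕ
evalWord n []       = idPerm (suc n)
evalWord n (x ∷ w) = compose (letterPerm n x) (evalWord n w)

descWord : ℕ → ℕ → List Letter
descWord j k = map (λ t → (j ∸ t , false)) (upTo k)

-- R^A_j = {1, a_j, a_j a_{j-1}, …, a_j⋯a_2 a_1, a_j⋯a_2 a_1^{-1}} as words
RA : ℕ → List (List Letter)
RA j = map (descWord j) (upTo (suc j)) ++ ((descWord j (j ∸ 1) ++ ((1 , true) ∷ [])) ∷ [])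

canonWords : ℕ → List (List Letter)
canonWords zero    = [] ∷ []
canonWords (suc m) = concatMap (λ w → map (λ r → w ++ r) (RA (suc m))) (canonWords m)

-- ℓ_A(σ) for σ ∈ A_{n+1}: number of letters in the (unique) canonical word
-- v_1 ⋯ v_{n-1} representing σ (the first one found; 0 if none)
lenA : ℕ → List ℕ → ℕ
lenA n σ = go (canonWords (n ∸ 1))
  where
  go : List (List Letter) → ℕ
  go []       = 0
  go (w ∷ ws) = if listEqᵇ (evalWord n w) σ then length w else go ws

isDesA : ℕ → List ℕ → ℕ → Bool
isDesA n σ i = lenA n (compose σ (aGen n i)) ≤ᵇ lenA n σ

rmajA : ℕ → List ℕ → ℕ
rmajA n σ = sum (map (λ i → n ∸ i) (filterᵇ (isDesA n σ) (range (n ∸ 1))))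

desASubᵇ : ℕ → List ℕ → List ℕ → Bool
desASubᵇ n σ D = all (λ i → not (isDesA n σ i) ∨ memᵇ i D) (range (n ∸ 1))

isDelA : List ℕ → ℕ → Bool
isDelA w i = count (λ j → at w j <ᵇ at w i) (interval 1 (i ∸ 1)) ≤ᵇ 1

delASubᵇ : ℕ → List ℕ → List ℕ → Bool
delASubᵇ n w D = all (λ i → not (isDelA w i) ∨ memᵇ i D) (interval 3 (suc n))

-- Generating polynomials: Σ_{x ∈ xs} q^{f x} is represented by its
-- coefficient sequence; coeff xs f k = coefficient of q^k.

coeff : {A : Set} → List A → (A → ℕ) → ℕ → ℕ
coeff xs f k = count (λ x → f x ≡ᵇ k) xs

SubsetOf : List ℕ → ℕ → Set
SubsetOf D m = Data.List.Relation.Unary.All.All (λ i → (1 ≤ i) × (i ≤ m)) D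
  where import Data.List.Relation.Unary.All

SIndex : ℕ → List ℕ → List ℕ → List (List ℕ)
SIndex n D₁ D₂ = filterᵇ (λ π → desSSubᵇ (inverse π) D₁ ∧ delSSubᵇ (inverse π) D₂) (Sym n)

AIndex : ℕ → List ℕ → List ℕ → List (List ℕ)
AIndex n D₁ D₂ = filterᵇ (λ σ → desASubᵇ n (inverse σ) D₁ ∧ delASubᵇ n (inverse σ) D₂) (Alt (suc n))

{-# OPTIONS --safe #-}
module Submission where

-- (1) Foata's bijection, run from right to left: put x in front of the transform of w, after cutting the latter into
-- blocks, each starting with a letter on the same side of x as the first letter of w, and moving the first letter of each
-- block to its end. In total x and these moves add |w| inversions if x exceeds the first letter of w, and none otherwise,
-- so inv of the transform is rmaj. Letters on the same side of x keep their relative order, hence the relative order of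
-- i and i+1 and the values of the left-to-right minima, i.e. Des and Del of the inverse, do not change.
--
-- (2) Moving the value of each left-to-right minimum of v ∈ S_{n+1} to the place of the next one (the value 1 and the
-- first place are dropped) gives π ∈ S_n. This map commutes with inversion and is unchanged under v ↦ v s₁; replacing v
-- by v a_i replaces π by π s_i, or leaves it alone when π has a descent at i. Hence ℓ_A, Des_A, Del_A of v are
-- ℓ_S, Des_S and 1 + Del_S of π. A permutation v is determined by π and its own set of left-to-right minima, any set
-- consisting of 1 and left-to-right minima of π (values raised by 1) being allowed; as Foata's bijection preserves the
-- latter, it lifts to S_{n+1}. Finally v ↦ v s₁ identifies sums over A_{n+1} with half the sums over S_{n+1}.

open import Defs
open import Data.Bool using (Bool; true; false; if_then_else_; _∧_; _∨_; not; T)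
open import Data.Bool.ListAction using (all)
open import Data.Bool.Properties using (T?; not-involutive; not-injective)
open import Data.Empty using (⊥-elim)
open import Data.List using (List; []; _∷_; _++_; map; length; concatMap; upTo; applyUpTo; filterᵇ; foldr; take)
open import Data.List.Properties using (++-identityʳ; length-map; length-applyUpTo; map-applyUpTo; map-∘; map-cong; map-cong-local; map-id; ∷-injectiveˡ; ∷-injectiveʳ; ++-assoc; upTo-∷ʳ; map-++; length-++; ≡-dec)
open import Data.List.Membership.Propositional using (_∈_; _∉_)
open import Data.List.Membership.Propositional.Properties using (∈-map⁺; ∈-map⁻; ∈-++⁺ˡ; ∈-++⁺ʳ; ∈-++⁻; ∈-filter⁺; ∈-filter⁻; ∈-concat⁺′; ∈-concat⁻′; ∈-upTo⁺; ∈-upTo⁻; ∈-∃++)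
open import Data.List.Relation.Binary.Permutation.Propositional using (_↭_; prep; swap; ↭-refl; ↭-reflexive; ↭-sym; ↭-trans)
open import Data.List.Relation.Binary.Permutation.Propositional.Properties using (∈-resp-↭; All-resp-↭; ↭-length; filter-↭; shift; drop-∷; ¬x∷xs↭[]) renaming (map⁺ to ↭-map)
open import Data.List.Relation.Unary.All as All using (All; []; _∷_)
open import Data.List.Relation.Unary.Any using (here; there)
open import Data.List.Relation.Unary.AllPairs using ([]; _∷_)
open import Data.List.Relation.Unary.Unique.Propositional using (Unique)
import Data.List.Relation.Unary.Unique.Propositional.Properties as Unique
import Data.List.Relation.Unary.All.Properties as All
open import Data.Nat
open import Data.Nat.ListAction using (sum)
open import Data.Nat.Properties
open import Data.Nat.Tactic.RingSolver using (solve-∀)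
open import Data.Product using (∃; ∃₂; _×_; _,_; proj₁; proj₂)
open import Data.Sum as Sum using (_⊎_; inj₁; inj₂)
open import Data.Unit using (tt)
open import Function using (_∘_; id; _$_; case_of_)
open import Relation.Binary.PropositionalEquality
open import Relation.Binary.Definitions using (Tri; tri<; tri≈; tri>)
open import Relation.Nullary using (yes; no)

-- The lift of Foata's bijection ignores parity: it sends `[1,3,2,4]` to `[1,3,4,2]`. It therefore
-- cannot be used inside A_{n+1}; the two sums are compared over S_{n+1} and halved. The fibre of
-- the covering map over π has 2^r elements, r being the number of left-to-right minima of π. As its
-- size varies with π, the lift has to carry the minima of v along. The length ℓ_A is defined by a
-- search through all canonical words, so it offers no recursion. The covering map explains it: in
-- the factor v_j the value j+2 travels to the left past smaller values, one place for each letter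
-- (a final inverse of a_1 takes it from the third place to the first), and each letter adds exactly
-- one inversion to the cover. The same journey read backwards produces a canonical word for every
-- even permutation. A generator that leaves the cover alone does so at a descent, which agrees with
-- the weak inequality in the definition of Des_A.

variable
  A B : Set

-- Booleans and comparisons

T-true : ∀ {b} → T b → b ≡ true
T-true {true} _ = refl

true-T : ∀ {b} → b ≡ true → T b
true-T refl = tt

bool-≡ : ∀ {a b} → (T a → T b) → (T b → T a) → a ≡ b
bool-≡ {false} {false} f g = refl
bool-≡ {false} {true}  f g = ⊥-elim (g tt)
bool-≡ {true}  {false} f g = ⊥-elim (f tt)
bool-≡ {true}  {true}  f g = refl

<ᵇ-true : ∀ {m n} → m < n → (m <ᵇ n) ≡ true
<ᵇ-true m<n = T-true (<⇒<ᵇ m<n)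

<ᵇ-false : ∀ {m n} → n ≤ m → (m <ᵇ n) ≡ false
<ᵇ-false {m} {n} n≤m = bool-≡ (λ t → ⊥-elim (<⇒≱ (<ᵇ⇒< m n t) n≤m)) ⊥-elim

<ᵇ-true⁻ : ∀ m n → (m <ᵇ n) ≡ true → m < n
<ᵇ-true⁻ m n e = <ᵇ⇒< m n (true-T e)

<ᵇ-false⁻ : ∀ m n → (m <ᵇ n) ≡ false → n ≤ m
<ᵇ-false⁻ m n e = ≮⇒≥ λ m<n → case trans (sym e) (<ᵇ-true m<n) of λ ()

≡ᵇ-true : ∀ {m n} → m ≡ n → (m ≡ᵇ n) ≡ true
≡ᵇ-true {m} {n} e = T-true (≡⇒≡ᵇ m n e)

≡ᵇ-false : ∀ {m n} → m ≢ n → (m ≡ᵇ n) ≡ false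
≡ᵇ-false {m} {n} m≢n = bool-≡ (λ t → ⊥-elim (m≢n (≡ᵇ⇒≡ m n t))) ⊥-elim

-- Counting

bit : Bool → ℕ
bit b = if b then 1 else 0

count-∷ : (p : A → Bool) (x : A) (xs : List A) → count p (x ∷ xs) ≡ bit (p x) + count p xs
count-∷ p x xs with p x
... | true  = refl
... | false = refl

count-map : (p : B → Bool) (f : A → B) (xs : List A) → count p (map f xs) ≡ count (p ∘ f) xs
count-map p f []       = refl
count-map p f (x ∷ xs) = trans (count-∷ p (f x) (map f xs))
  (trans (cong (bit (p (f x)) +_) (count-map p f xs)) (sym (count-∷ (p ∘ f) x xs)))

count-cong : {p q : A → Bool} (xs : List A) → (∀ {x} → x ∈ xs → p x ≡ q x) → count p xs ≡ count q xs
count-cong         []       h = refl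
count-cong {p = p} {q} (x ∷ xs) h = trans (count-∷ p x xs)
  (trans (cong₂ (λ b c → bit b + c) (h (here refl)) (count-cong xs (h ∘ there))) (sym (count-∷ q x xs)))

count-++ : (p : A → Bool) (xs ys : List A) → count p (xs ++ ys) ≡ count p xs + count p ys
count-++ p []       ys = refl
count-++ p (x ∷ xs) ys = trans (count-∷ p x (xs ++ ys)) (trans (cong (bit (p x) +_) (count-++ p xs ys))
  (trans (sym (+-assoc (bit (p x)) (count p xs) (count p ys))) (cong (_+ count p ys) (sym (count-∷ p x xs)))))

count-filter : (p q : A → Bool) (xs : List A) → count p (filterᵇ q xs) ≡ count (λ x → q x ∧ p x) xs
count-filter p q []       = refl
count-filter p q (x ∷ xs) with q x
... | false = count-filter p q xs
... | true  with p x
...   | true  = cong suc (count-filter p q xs)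
...   | false = count-filter p q xs

count-split : (p : A → Bool) (xs : List A) → count p xs + count (not ∘ p) xs ≡ length xs
count-split p []       = refl
count-split p (x ∷ xs) with p x
... | true  = cong suc (count-split p xs)
... | false = trans (+-suc (count p xs) (count (not ∘ p) xs)) (cong suc (count-split p xs))

count-↭ : (p : A → Bool) {xs ys : List A} → xs ↭ ys → count p xs ≡ count p ys
count-↭ p xs↭ys = ↭-length (filter-↭ (T? ∘ p) xs↭ys)

∈-filterᵇ⁺ : (p : A → Bool) {x : A} {xs : List A} → x ∈ xs → p x ≡ true → x ∈ filterᵇ p xs
∈-filterᵇ⁺ p x∈xs px = ∈-filter⁺ (T? ∘ p) x∈xs (true-T px)

∈-filterᵇ⁻ : (p : A → Bool) {x : A} {xs : List A} → x ∈ filterᵇ p xs → x ∈ xs × p x ≡ true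
∈-filterᵇ⁻ p {xs = xs} x∈ with ∈-filter⁻ (T? ∘ p) {xs = xs} x∈
... | x∈xs , px = x∈xs , T-true px

all-cong : {p q : A → Bool} (xs : List A) → (∀ {x} → x ∈ xs → p x ≡ q x) → all p xs ≡ all q xs
all-cong []       h = refl
all-cong (x ∷ xs) h = cong₂ _∧_ (h (here refl)) (all-cong xs (h ∘ there))

all-true : {p : A → Bool} (xs : List A) → (∀ {x} → x ∈ xs → p x ≡ true) → all p xs ≡ true
all-true []       h = refl
all-true (x ∷ xs) h rewrite h (here refl) = all-true xs (h ∘ there)

all-true⁻ : {p : A → Bool} (xs : List A) → all p xs ≡ true → ∀ {x} → x ∈ xs → p x ≡ true
all-true⁻ {p = p} (x ∷ xs) e y∈ with p x in px
all-true⁻ (x ∷ xs) e (here refl) | true = px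
all-true⁻ (x ∷ xs) e (there y∈)  | true = all-true⁻ xs e y∈

all-map : (p : B → Bool) (f : A → B) (xs : List A) → all p (map f xs) ≡ all (p ∘ f) xs
all-map p f []       = refl
all-map p f (x ∷ xs) = cong (p (f x) ∧_) (all-map p f xs)

filterᵇ-cong : {p q : A → Bool} (xs : List A) → (∀ {x} → x ∈ xs → p x ≡ q x) → filterᵇ p xs ≡ filterᵇ q xs
filterᵇ-cong []       h = refl
filterᵇ-cong {p = p} {q} (x ∷ xs) h with p x | q x | h (here refl)
... | true  | .true  | refl = cong (x ∷_) (filterᵇ-cong xs (h ∘ there))
... | false | .false | refl = filterᵇ-cong xs (h ∘ there)

-- Lists without repetitions

∉-All : {x : A} {xs : List A} → All (x ≢_) xs → x ∉ xs
∉-All (x≢y ∷ _)  (here refl) = x≢y refl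
∉-All (_ ∷ x≢xs) (there x∈)  = ∉-All x≢xs x∈

Unique-resp-↭ : {xs ys : List A} → xs ↭ ys → Unique xs → Unique ys
Unique-resp-↭ _↭_.refl        u = u
Unique-resp-↭ (prep x r)      (x≢ ∷ u) = All-resp-↭ r x≢ ∷ Unique-resp-↭ r u
Unique-resp-↭ (swap x y r)    ((x≢y ∷ x≢) ∷ y≢ ∷ u) =
  ((x≢y ∘ sym) ∷ All-resp-↭ r y≢) ∷ All-resp-↭ r x≢ ∷ Unique-resp-↭ r u
Unique-resp-↭ (_↭_.trans r s) u = Unique-resp-↭ s (Unique-resp-↭ r u)

unique-⊆-length : {xs ys : List A} → Unique xs → (∀ {x} → x ∈ xs → x ∈ ys) → length xs ≤ length ys
-- Pigeonhole: each step strikes the head of `xs` out of `ys`, and the bound on the lengths leaves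
-- nothing of `ys` at the end.
unique-⊆-↭ : {xs ys : List A} → Unique xs → (∀ {x} → x ∈ xs → x ∈ ys) → length ys ≤ length xs → xs ↭ ys

remove : {x : A} {ys : List A} → x ∈ ys → ∃ λ zs → ys ↭ x ∷ zs
remove x∈ys with ∈-∃++ x∈ys
... | us , vs , refl = us ++ vs , shift _ us vs

⊆-remove : {x : A} {xs ys zs : List A} → All (x ≢_) xs → (∀ {z} → z ∈ x ∷ xs → z ∈ ys) → ys ↭ x ∷ zs →
  ∀ {z} → z ∈ xs → z ∈ zs
⊆-remove x≢ h r z∈xs with ∈-resp-↭ r (h (there z∈xs))
... | here refl = ⊥-elim (∉-All x≢ z∈xs)
... | there z∈  = z∈

unique-⊆-length {xs = []}     u h = z≤n
unique-⊆-length {xs = x ∷ xs} (x≢ ∷ u) h with remove (h (here refl))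
... | zs , r = ≤-trans (s≤s (unique-⊆-length u (⊆-remove x≢ h r))) (≤-reflexive (sym (↭-length r)))

unique-⊆-↭ {xs = []}     {[]} u h l = ↭-refl
unique-⊆-↭ {xs = x ∷ xs} (x≢ ∷ u) h l with remove (h (here refl))
... | zs , r = ↭-trans (prep x (unique-⊆-↭ u (⊆-remove x≢ h r)
  (s≤s⁻¹ (≤-trans (≤-reflexive (sym (↭-length r))) l)))) (↭-sym r)

unique-map : {h : A → B} {xs : List A} → Unique xs →
  (∀ {x y} → x ∈ xs → y ∈ xs → h x ≡ h y → x ≡ y) → Unique (map h xs)
unique-map {xs = []}     u inj = []
unique-map {h = h} {xs = x ∷ xs} (x≢ ∷ u) inj =
  All.tabulate (λ z∈ e → let (y , y∈ , e′) = ∈-map⁻ h z∈ in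
    ∉-All x≢ (subst (_∈ xs) (sym (inj (here refl) (there y∈) (trans e e′))) y∈))
  ∷ unique-map u (λ x∈ y∈ → inj (there x∈) (there y∈))

-- An injective self-map of a finite set is onto, so `map h xs` rearranges `xs`. Through this,
-- Foata's map and its lift only have to be shown injective.
count-injective : {h : A → A} {xs : List A} → Unique xs → (∀ {x} → x ∈ xs → h x ∈ xs) →
  (∀ {x y} → x ∈ xs → y ∈ xs → h x ≡ h y → x ≡ y) → (p : A → Bool) → count (p ∘ h) xs ≡ count p xs
count-injective {h = h} {xs} u into inj p = trans (sym (count-map p h xs)) (count-↭ p
  (unique-⊆-↭ (unique-map u inj)
    (λ z∈ → let (x , x∈ , e) = ∈-map⁻ h z∈ in subst (_∈ xs) (sym e) (into x∈))
    (≤-reflexive (sym (length-map h xs)))))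

∈-concatMap⁺ : (f : A → List B) {xs : List A} {x : A} {y : B} → x ∈ xs → y ∈ f x → y ∈ concatMap f xs
∈-concatMap⁺ f x∈ y∈ = ∈-concat⁺′ y∈ (∈-map⁺ f x∈)

∈-concatMap⁻ : (f : A → List B) (xs : List A) {y : B} → y ∈ concatMap f xs → ∃ λ x → x ∈ xs × y ∈ f x
∈-concatMap⁻ f xs y∈ with ∈-concat⁻′ (map f xs) y∈
... | ys , y∈ys , ys∈ with ∈-map⁻ f ys∈
...   | x , x∈ , refl = x , x∈ , y∈ys

unique-concatMap : {f : A → List B} {xs : List A} → Unique xs → (∀ x → Unique (f x)) →
  (∀ {x y z} → z ∈ f x → z ∈ f y → x ≡ y) → Unique (concatMap f xs)
unique-concatMap {xs = []}     u uf d = []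
unique-concatMap {f = f} {xs = x ∷ xs} (x≢ ∷ u) uf d = Unique.++⁺ (uf x) (unique-concatMap u uf d)
  (λ (z∈ , z∈′) → let (y , y∈ , z∈fy) = ∈-concatMap⁻ f xs z∈′ in
    ∉-All x≢ (subst (_∈ xs) (sym (d z∈ z∈fy)) y∈))

-- Words and 1-based positions

range-applyUpTo : ∀ m → range m ≡ applyUpTo suc m
range-applyUpTo m = map-applyUpTo id suc m

range-suc : ∀ m → range (suc m) ≡ 1 ∷ map suc (range m)
range-suc m = cong (1 ∷_) (trans (map-applyUpTo suc suc m)
  (sym (trans (cong (map suc) (range-applyUpTo m)) (map-applyUpTo suc suc m))))

length-range : ∀ m → length (range m) ≡ m
length-range m = trans (cong length (range-applyUpTo m)) (length-applyUpTo suc m)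

∈-range⁺ : ∀ {i m} → i < m → suc i ∈ range m
∈-range⁺ i<m = ∈-map⁺ suc (∈-upTo⁺ i<m)

∈-range⁻ : ∀ {x m} → x ∈ range m → ∃ λ i → i < m × x ≡ suc i
∈-range⁻ x∈ with ∈-map⁻ suc x∈
... | i , i∈ , e = i , ∈-upTo⁻ i∈ , e

unique-range : ∀ m → Unique (range m)
unique-range m = Unique.map⁺ suc-injective (Unique.upTo⁺ m)

∈-interval⁻ : ∀ {x} a b → x ∈ interval a b → a ≤ x × x ≤ b
∈-interval⁻ a b x∈ with ∈-map⁻ (a +_) x∈
... | t , t∈ , refl = m≤m+n a t , s≤s⁻¹ (lem (∈-upTo⁻ t∈))
  where
  lem : t < suc b ∸ a → suc (a + t) ≤ suc b
  lem t< = subst (suc (a + t) ≤_) (m+[n∸m]≡n (<⇒≤ (m∸n≢0⇒n<m {suc b} {a} λ e → n≮0 (subst (t <_) e t<))))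
    (subst (_≤ a + (suc b ∸ a)) (+-suc a t) (+-monoʳ-≤ a t<))

∈-interval⁺ : ∀ {x} a b → a ≤ x → x ≤ b → x ∈ interval a b
∈-interval⁺ {x} a b a≤x x≤b = subst (_∈ interval a b) (m+[n∸m]≡n a≤x)
  (∈-map⁺ (a +_) (∈-upTo⁺ (subst (x ∸ a <_) (sym (+-∸-assoc 1 (≤-trans a≤x x≤b))) (s≤s (∸-monoˡ-≤ a x≤b)))))

interval-suc : ∀ a b → interval (suc a) (suc b) ≡ map suc (interval a b)
interval-suc a b = map-∘ (upTo (suc b ∸ a))

at-zero : ∀ w → at w 0 ≡ 0
at-zero []      = refl
at-zero (_ ∷ _) = refl

at-∈ : ∀ w {i} → i < length w → at w (suc i) ∈ w
at-∈ (x ∷ w) {zero}  _       = here refl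
at-∈ (x ∷ w) {suc i} (s≤s l) = there (at-∈ w l)

∈-at : ∀ {x w} → x ∈ w → ∃ λ i → i < length w × at w (suc i) ≡ x
∈-at (here refl) = 0 , z<s , refl
∈-at (there x∈) with ∈-at x∈
... | i , l , e = suc i , s≤s l , e

at-map : ∀ (h : ℕ → ℕ) w {i} → i < length w → at (map h w) (suc i) ≡ h (at w (suc i))
at-map h (x ∷ w) {zero}  _       = refl
at-map h (x ∷ w) {suc i} (s≤s l) = at-map h w l

at-ext : ∀ u w → length u ≡ length w → (∀ {i} → i < length u → at u (suc i) ≡ at w (suc i)) → u ≡ w
at-ext []      []      l h = refl
at-ext (x ∷ u) (y ∷ w) l h = cong₂ _∷_ (h z<s) (at-ext u w (suc-injective l) (h ∘ s≤s))

at-applyUpTo : ∀ (h : ℕ → ℕ) {m i} → i < m → at (applyUpTo h m) (suc i) ≡ h i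
at-applyUpTo h {suc m} {zero}  _       = refl
at-applyUpTo h {suc m} {suc i} (s≤s l) = at-applyUpTo (h ∘ suc) l

at-range : ∀ {m i} → i < m → at (range m) (suc i) ≡ suc i
at-range {m} {i} l = trans (cong (λ u → at u (suc i)) (range-applyUpTo m)) (at-applyUpTo suc l)

at-map-range : ∀ (h : ℕ → ℕ) {m i} → i < m → at (map h (range m)) (suc i) ≡ h (suc i)
at-map-range h {m} {i} l = trans (at-map h (range m) (subst (i <_) (sym (length-range m)) l)) (cong h (at-range l))

at-injective : ∀ {w i j} → Unique w → i < length w → j < length w → at w (suc i) ≡ at w (suc j) → i ≡ j
at-injective {x ∷ w} {zero}  {zero}  u l m e = refl
at-injective {x ∷ w} {zero}  {suc j} (x≢ ∷ u) l (s≤s m) e = ⊥-elim (∉-All x≢ (subst (_∈ w) (sym e) (at-∈ w m)))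
at-injective {x ∷ w} {suc i} {zero}  (x≢ ∷ u) (s≤s l) m e = ⊥-elim (∉-All x≢ (subst (_∈ w) e (at-∈ w l)))
at-injective {x ∷ w} {suc i} {suc j} (x≢ ∷ u) (s≤s l) (s≤s m) e = cong suc (at-injective u l m e)

map-at-interval : ∀ w k → k ≤ length w → map (at w) (interval 1 k) ≡ take k w
map-at-interval w k l = trans (sym (map-∘ (upTo k))) (trans (map-applyUpTo id (at w ∘ suc) k) (go w k l))
  where
  go : ∀ w k → k ≤ length w → applyUpTo (at w ∘ suc) k ≡ take k w
  go w       zero    l       = refl
  go (x ∷ w) (suc k) (s≤s l) = cong (x ∷_) (go w k l)

position-∈ : ∀ {j w} → j ∈ w → ∃ λ i → i < length w × position j w ≡ suc i × at w (suc i) ≡ j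
position-∈ {j} {x ∷ w} j∈ with j ≡ᵇ x in e
... | true  = 0 , z<s , refl , sym (≡ᵇ⇒≡ j x (true-T e))
position-∈ {j} {x ∷ w} (here refl) | false = ⊥-elim (case trans (sym (≡ᵇ-true {j} refl)) e of λ ())
position-∈ {j} {x ∷ w} (there j∈)  | false with position-∈ j∈
... | i , l , p , a rewrite p = suc i , s≤s l , refl , a

-- Permutations of [n] in one-line notation

record IsPerm (n : ℕ) (w : List ℕ) : Set where
  constructor perm
  field
    ↭-range : w ↭ range n

perm-length : ∀ {n w} → IsPerm n w → length w ≡ n
perm-length {n} (perm r) = trans (↭-length r) (length-range n)

perm-unique : ∀ {n w} → IsPerm n w → Unique w
perm-unique {n} (perm r) = Unique-resp-↭ (↭-sym r) (unique-range n)

perm-∈ : ∀ {n w i} → IsPerm n w → i < n → suc i ∈ w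
perm-∈ (perm r) i<n = ∈-resp-↭ (↭-sym r) (∈-range⁺ i<n)

∈-perm⁻ : ∀ {n w x} → IsPerm n w → x ∈ w → ∃ λ k → k < n × x ≡ suc k
∈-perm⁻ (perm r) x∈ = ∈-range⁻ (∈-resp-↭ r x∈)

perm-resp-↭ : ∀ {n u w} → u ↭ w → IsPerm n w → IsPerm n u
perm-resp-↭ r (perm s) = perm (↭-trans r s)

perm-at : ∀ {n w i} → IsPerm n w → i < n → ∃ λ k → k < n × at w (suc i) ≡ suc k
perm-at {w = w} r i<n = ∈-perm⁻ r (at-∈ w (subst (_ <_) (sym (perm-length r)) i<n))

perm-criterion : ∀ {n w} → Unique w → length w ≡ n → (∀ {x} → x ∈ w → x ∈ range n) → IsPerm n w
perm-criterion {n} u l h = perm $ unique-⊆-↭ u h (≤-reflexive (trans (length-range n) (sym l)))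

length-inverse : ∀ w → length (inverse w) ≡ length w
length-inverse w = trans (length-map _ (range (length w))) (length-range (length w))

module _ {n : ℕ} {w : List ℕ} (r : IsPerm n w) where

  at-inverse : ∀ {j} → j < n → at (inverse w) (suc j) ≡ position (suc j) w
  at-inverse {j} l = at-map-range (λ j → position j w) (subst (j <_) (sym (perm-length r)) l)

  inverse-at : ∀ {j} → j < n → ∃ λ i → i < n × at (inverse w) (suc j) ≡ suc i × at w (suc i) ≡ suc j
  inverse-at l with position-∈ (perm-∈ r l)
  ... | i , i< , p , a = i , subst (i <_) (perm-length r) i< , trans (at-inverse l) p , a

  at-inverse-eq : ∀ {i j} → i < n → j < n → at w (suc i) ≡ suc j → at (inverse w) (suc j) ≡ suc i
  at-inverse-eq {i} i< j< e with inverse-at j<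
  ... | i′ , i′< , p , a = trans p (cong suc (at-injective (perm-unique r)
    (subst (i′ <_) (sym (perm-length r)) i′<) (subst (i <_) (sym (perm-length r)) i<) (trans a (sym e))))

  inverse-perm : IsPerm n (inverse w)
  inverse-perm = perm-criterion
    (unique-map (unique-range (length w)) (λ x∈ y∈ e → inj (dom x∈) (dom y∈) e))
    (trans (length-inverse w) (perm-length r))
    (λ x∈ → let (j , j∈ , e) = ∈-map⁻ _ x∈ in img (dom j∈) e)
    where
    dom : ∀ {x} → x ∈ range (length w) → ∃ λ i → i < n × x ≡ suc i
    dom x∈ = subst (λ m → ∃ λ i → i < m × _ ≡ suc i) (perm-length r) (∈-range⁻ x∈)
    inj : ∀ {x y} → (∃ λ i → i < n × x ≡ suc i) → (∃ λ i → i < n × y ≡ suc i) → position x w ≡ position y w → x ≡ y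
    inj (i , l , refl) (j , m , refl) e with position-∈ (perm-∈ r l) | position-∈ (perm-∈ r m)
    ... | _ , _ , p , a | _ , _ , q , b = trans (sym a) (trans (cong (at w) (trans (sym p) (trans e q))) b)
    img : ∀ {x y} → (∃ λ i → i < n × y ≡ suc i) → x ≡ position y w → x ∈ range n
    img (i , l , refl) e with position-∈ (perm-∈ r l)
    ... | k , k< , p , _ = subst (_∈ range n) (sym (trans e p)) (∈-range⁺ (subst (k <_) (perm-length r) k<))

∈-allWords⁺ : ∀ m {xs w} → length w ≡ m → (∀ {x} → x ∈ w → x ∈ xs) → w ∈ allWords m xs
∈-allWords⁺ zero    {w = []}    l h = here refl
∈-allWords⁺ (suc m) {w = x ∷ w} l h = ∈-concatMap⁺ (λ x → map (x ∷_) (allWords m _)) (h (here refl))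
  (∈-map⁺ (x ∷_) (∈-allWords⁺ m (suc-injective l) (h ∘ there)))

∈-allWords⁻ : ∀ m {xs w} → w ∈ allWords m xs → length w ≡ m × (∀ {x} → x ∈ w → x ∈ xs)
∈-allWords⁻ zero    (here refl) = refl , λ ()
∈-allWords⁻ (suc m) {xs} w∈ with ∈-concatMap⁻ (λ x → map (x ∷_) (allWords m xs)) xs w∈
... | x , x∈ , w∈′ with ∈-map⁻ (x ∷_) w∈′
...   | w , w∈″ , refl with ∈-allWords⁻ m w∈″
...     | l , h = cong suc l , λ { (here refl) → x∈ ; (there z∈) → h z∈ }

unique-allWords : ∀ m {xs} → Unique xs → Unique (allWords m xs)
unique-allWords zero    u = [] ∷ []
unique-allWords (suc m) u = unique-concatMap u (λ x → Unique.map⁺ ∷-injectiveʳ (unique-allWords m u)) disj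
  where
  disj : ∀ {x y z} → z ∈ map (x ∷_) (allWords m _) → z ∈ map (y ∷_) (allWords m _) → x ≡ y
  disj z∈ z∈′ with ∈-map⁻ _ z∈ | ∈-map⁻ _ z∈′
  ... | _ , _ , refl | _ , _ , refl = refl

unique-at : ∀ w → (∀ {i j} → i < j → j < length w → at w (suc i) ≢ at w (suc j)) → Unique w
unique-at []      h = []
unique-at (x ∷ w) h = All.tabulate (λ y∈ e → let (j , l , a) = ∈-at y∈ in h {0} {suc j} z<s (s≤s l) (trans e (sym a)))
  ∷ unique-at w (λ i<j l → h (s≤s i<j) (s≤s l))

distinctᵇ⇒Unique : ∀ w → distinctᵇ w ≡ true → Unique w
distinctᵇ⇒Unique w d = unique-at w λ {i} {j} i<j l e →
  case trans (sym (all-true⁻ (interval 1 j) (all-true⁻ (range (length w)) d (∈-range⁺ l))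
    (∈-interval⁺ 1 j (s≤s z≤n) i<j))) (cong not (≡ᵇ-true e)) of λ ()

Unique⇒distinctᵇ : ∀ w → Unique w → distinctᵇ w ≡ true
Unique⇒distinctᵇ w u = all-true (range (length w)) λ j∈ → helper (∈-range⁻ j∈)
  where
  helper : ∀ {j} → (∃ λ k → k < length w × j ≡ suc k) →
    all (λ i → not (at w i ≡ᵇ at w j)) (interval 1 (j ∸ 1)) ≡ true
  helper (k , k< , refl) = all-true (interval 1 k) λ {x} x∈ → pos x (∈-interval⁻ 1 k x∈)
    where
    pos : ∀ x → 1 ≤ x × x ≤ k → not (at w x ≡ᵇ at w (suc k)) ≡ true
    pos (suc i) (_ , i<k) = cong not (≡ᵇ-false λ e → <⇒≢ i<k (at-injective u (<-trans i<k k<) k< e))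

∈-Sym⁻ : ∀ {n w} → w ∈ Sym n → IsPerm n w
∈-Sym⁻ {n} {w} w∈ with ∈-filterᵇ⁻ distinctᵇ {xs = allWords n (range n)} w∈
... | w∈′ , d with ∈-allWords⁻ n w∈′
...   | l , h = perm-criterion (distinctᵇ⇒Unique w d) l h

∈-Sym⁺ : ∀ {n w} → IsPerm n w → w ∈ Sym n
∈-Sym⁺ {n} {w} r = ∈-filterᵇ⁺ distinctᵇ (∈-allWords⁺ n (perm-length r) (∈-resp-↭ (IsPerm.↭-range r))) (Unique⇒distinctᵇ w (perm-unique r))

unique-Sym : ∀ n → Unique (Sym n)
unique-Sym n = Unique.filter⁺ (T? ∘ distinctᵇ) (unique-allWords n (unique-range n))

-- Inversions and reverse major index by recursion on the word

inv : List ℕ → ℕ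
inv []      = 0
inv (x ∷ w) = count (_<ᵇ x) w + inv w

-- A descent at position i of a word of length n weighs n - i, which is the number of letters behind
-- it; this turns `rmajS` into a recursion on suffixes.
rmaj : List ℕ → ℕ
rmaj []          = 0
rmaj (x ∷ [])    = 0
rmaj (x ∷ y ∷ w) = bit (y <ᵇ x) * length (y ∷ w) + rmaj (y ∷ w)

count-concatMap : (p : B → Bool) (f : A → List B) (xs : List A) →
  count p (concatMap f xs) ≡ sum (map (λ x → count p (f x)) xs)
count-concatMap p f []       = refl
count-concatMap p f (x ∷ xs) = trans (count-++ p (f x) (concatMap f xs)) (cong (count p (f x) +_) (count-concatMap p f xs))

inversionsAt : List ℕ → ℕ → ℕ
inversionsAt w i = count (λ j → at w j <ᵇ at w i) (interval (suc i) (length w))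

lenS-sum : ∀ w → lenS w ≡ sum (map (inversionsAt w) (range (length w)))
lenS-sum w = trans (count-concatMap _ _ (range (length w)))
  (cong sum (map-cong (λ i → count-map _ (i ,_) (interval (suc i) (length w))) (range (length w))))

inversionsAt-suc : ∀ x w i → inversionsAt (x ∷ w) (suc (suc i)) ≡ inversionsAt w (suc i)
inversionsAt-suc x w i = trans (cong (count _) (interval-suc (suc (suc i)) (length w)))
  (trans (count-map _ suc (interval (suc (suc i)) (length w)))
    (count-cong (interval (suc (suc i)) (length w)) λ j∈ → step (∈-interval⁻ (suc (suc i)) (length w) j∈)))
  where
  step : ∀ {j} → suc (suc i) ≤ j × j ≤ length w → (at (x ∷ w) (suc j) <ᵇ at w (suc i)) ≡ (at w j <ᵇ at w (suc i))
  step (s≤s _ , _) = refl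

inversionsAt-one : ∀ x w → inversionsAt (x ∷ w) 1 ≡ count (_<ᵇ x) w
inversionsAt-one x w = trans (cong (count _) (interval-suc 1 (length w)))
  (trans (count-map _ suc (interval 1 (length w)))
  (trans (count-cong (interval 1 (length w)) λ j∈ → step (∈-interval⁻ 1 (length w) j∈))
  (trans (sym (count-map (_<ᵇ x) (at w) (interval 1 (length w))))
    (cong (count (_<ᵇ x)) (trans (map-at-interval w (length w) ≤-refl) (take-all w))))))
  where
  step : ∀ {j} → 1 ≤ j × j ≤ length w → (at (x ∷ w) (suc j) <ᵇ x) ≡ (at w j <ᵇ x)
  step (s≤s _ , _) = refl
  take-all : ∀ (u : List ℕ) → take (length u) u ≡ u
  take-all []      = refl
  take-all (y ∷ u) = cong (y ∷_) (take-all u)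

lenS≡inv : ∀ w → lenS w ≡ inv w
lenS≡inv w = trans (lenS-sum w) (go w)
  where
  go : ∀ w → sum (map (inversionsAt w) (range (length w))) ≡ inv w
  go []      = refl
  go (x ∷ w) = trans (cong (sum ∘ map (inversionsAt (x ∷ w))) (range-suc (length w)))
    (cong₂ _+_ (inversionsAt-one x w) (trans (cong sum (lem (upTo (length w)))) (go w)))
    where
    lem : ∀ js → map (inversionsAt (x ∷ w)) (map suc (map suc js)) ≡ map (inversionsAt w) (map suc js)
    lem []       = refl
    lem (j ∷ js) = cong₂ _∷_ (inversionsAt-suc x w j) (lem js)

sum-filterᵇ : (p : A → Bool) (f : A → ℕ) (xs : List A) →
  sum (map f (filterᵇ p xs)) ≡ sum (map (λ x → bit (p x) * f x) xs)
sum-filterᵇ p f []       = refl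
sum-filterᵇ p f (x ∷ xs) with p x
... | true  = cong₂ _+_ (sym (+-identityʳ (f x))) (sum-filterᵇ p f xs)
... | false = sum-filterᵇ p f xs

descentWeight : List ℕ → ℕ → ℕ
descentWeight w i = bit (isDesS w i) * (length w ∸ i)

rmajS≡rmaj : ∀ w → rmajS w ≡ rmaj w
rmajS≡rmaj w = trans (sum-filterᵇ (isDesS w) (length w ∸_) (range (length w ∸ 1))) (go w)
  where
  go : ∀ w → sum (map (descentWeight w) (range (length w ∸ 1))) ≡ rmaj w
  go []          = refl
  go (x ∷ [])    = refl
  go (x ∷ y ∷ w) = trans (cong (sum ∘ map (descentWeight (x ∷ y ∷ w))) (range-suc (length w)))
    (cong (descentWeight (x ∷ y ∷ w) 1 +_) (trans (cong sum (lem (upTo (length w)))) (go (y ∷ w))))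
    where
    lem : ∀ js → map (descentWeight (x ∷ y ∷ w)) (map suc (map suc js)) ≡ map (descentWeight (y ∷ w)) (map suc js)
    lem []       = refl
    lem (j ∷ js) = cong₂ _∷_ refl (lem js)

-- Foata's bijection, read from right to left

module _ (p : ℕ → Bool) where

  -- The letter `c` opens the current block and is held back; it is put down when the next letter
  -- satisfying `p` opens a new block, or at the end of the word.
  carry : ℕ → List ℕ → List ℕ
  carry c []      = c ∷ []
  carry c (b ∷ w) = if p b then c ∷ carry b w else b ∷ carry c w

  carry-↭ : ∀ c w → carry c w ↭ c ∷ w
  carry-↭ c []      = ↭-refl
  carry-↭ c (b ∷ w) with p b
  ... | true  = prep c (carry-↭ b w)
  ... | false = ↭-trans (prep b (carry-↭ c w)) (swap b c ↭-refl)

  -- When `p c` holds, the output starts with a letter satisfying `p` exactly if the block of `c` is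
  -- `c` alone. So the cutting into blocks can be read off the output letter by letter; lengths
  -- settle the cases in which one word ends early.
  carry-injective : ∀ {c d} u w → p c ≡ true → p d ≡ true → carry c u ≡ carry d w → c ∷ u ≡ d ∷ w
  carry-injective [] [] pc pd e = e
  carry-injective {c} {d} [] (b ∷ w) pc pd e with p b in pb
  ... | true  = ⊥-elim (short (↭-length (↭-trans (↭-reflexive (∷-injectiveʳ e)) (carry-↭ b w))))
    where
    short : 0 ≢ suc (length w)
    short ()
  ... | false = ⊥-elim (case trans (sym pc) (trans (cong p (∷-injectiveˡ e)) pb) of λ ())
  carry-injective {c} {d} (a ∷ u) [] pc pd e with p a in pa
  ... | true  = ⊥-elim (short (↭-length (↭-trans (↭-reflexive (sym (∷-injectiveʳ e))) (carry-↭ a u))))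
    where
    short : 0 ≢ suc (length u)
    short ()
  ... | false = ⊥-elim (case trans (sym pa) (trans (cong p (∷-injectiveˡ e)) pd) of λ ())
  carry-injective {c} {d} (a ∷ u) (b ∷ w) pc pd e with p a in pa | p b in pb
  ... | true  | true  = cong₂ _∷_ (∷-injectiveˡ e) (carry-injective u w pa pb (∷-injectiveʳ e))
  ... | true  | false = ⊥-elim (case trans (sym pc) (trans (cong p (∷-injectiveˡ e)) pb) of λ ())
  ... | false | true  = ⊥-elim (case trans (sym pa) (trans (cong p (∷-injectiveˡ e)) pd) of λ ())
  ... | false | false with carry-injective u w pc pd (∷-injectiveʳ e) | ∷-injectiveˡ e
  ...   | refl | refl = refl

  -- Only letters satisfying `p` move, and only past letters failing it. If one of the two kinds
  -- acts as the identity, the actions commute.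
  carry-foldr : ∀ {R : Set} (s : ℕ → R → R) (z : R) →
    (∀ x → p x ≡ true → ∀ r → s x r ≡ r) ⊎ (∀ x → p x ≡ false → ∀ r → s x r ≡ r) →
    ∀ c w → p c ≡ true → foldr s z (carry c w) ≡ foldr s z (c ∷ w)
  carry-foldr s z inert c []      pc = refl
  carry-foldr s z inert c (b ∷ w) pc with p b in pb
  ... | true  = cong (s c) (carry-foldr s z inert b w pb)
  ... | false = trans (cong (s b) (carry-foldr s z inert c w pc)) (exchange inert)
    where
    r = foldr s z w
    exchange : (∀ x → p x ≡ true → ∀ r → s x r ≡ r) ⊎ (∀ x → p x ≡ false → ∀ r → s x r ≡ r) →
      s b (s c r) ≡ s c (s b r)
    exchange (inj₁ i) = trans (cong (s b) (i c pc r)) (sym (i c pc (s b r)))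
    exchange (inj₂ i) = trans (i b pb (s c r)) (cong (s c) (sym (i b pb r)))

lastOr : ℕ → List ℕ → ℕ
lastOr z []      = z
lastOr z (x ∷ w) = lastOr x w

-- The letter put down last opened the last block, and only letters satisfying `p` are ever carried.
carry-last : ∀ (p : ℕ → Bool) z c w → p c ≡ true → p (lastOr z (carry p c w)) ≡ true
carry-last p z c []      pc = pc
carry-last p z c (b ∷ w) pc with p b in pb
... | true  = carry-last p c b w pb
... | false = carry-last p b c w pc

-- Each letter of `w` that is not below `x` lies in exactly one block, so it is passed exactly once
-- by a letter below `x`, which creates one inversion.
inv-carry-small : ∀ x c w → (c <ᵇ x) ≡ true →
  inv (carry (_<ᵇ x) c w) ≡ inv (c ∷ w) + count (not ∘ (_<ᵇ x)) w
inv-carry-small x c []      c<x = refl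
inv-carry-small x c (b ∷ w) c<x with b <ᵇ x in b<x
... | true  rewrite count-↭ (_<ᵇ c) (carry-↭ (_<ᵇ x) b w) | inv-carry-small x b w b<x =
  sym (+-assoc (count (_<ᵇ c) (b ∷ w)) _ _)
... | false rewrite count-↭ (_<ᵇ b) (carry-↭ (_<ᵇ x) c w) | inv-carry-small x c w c<x
  | count-∷ (_<ᵇ b) c w | count-∷ (_<ᵇ c) b w
  | <ᵇ-true {c} {b} (<-≤-trans (<ᵇ-true⁻ c x c<x) (<ᵇ-false⁻ b x b<x))
  | <ᵇ-false {b} {c} (<⇒≤ (<-≤-trans (<ᵇ-true⁻ c x c<x) (<ᵇ-false⁻ b x b<x))) =
  arith (count (_<ᵇ b) w) (count (_<ᵇ c) w) (inv w) (count (not ∘ (_<ᵇ x)) w)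
  where
  arith : ∀ a b c d → suc (a + (b + c + d)) ≡ b + (a + c) + suc d
  arith = solve-∀

-- The mirror image: each letter of `w` below `x` is passed once by a letter that is not, which
-- destroys one inversion. The loss stands on the left to avoid truncated subtraction.
inv-carry-large : ∀ x c w → (c <ᵇ x) ≡ false →
  inv (carry (not ∘ (_<ᵇ x)) c w) + count (_<ᵇ x) w ≡ inv (c ∷ w)
inv-carry-large x c []      c≥x = refl
inv-carry-large x c (b ∷ w) c≥x with b <ᵇ x in b<x
... | false rewrite count-↭ (_<ᵇ c) (carry-↭ (not ∘ (_<ᵇ x)) b w) =
  trans (+-assoc (count (_<ᵇ c) (b ∷ w)) _ _) (cong (count (_<ᵇ c) (b ∷ w) +_) (inv-carry-large x b w b<x))
... | true  rewrite count-↭ (_<ᵇ b) (carry-↭ (not ∘ (_<ᵇ x)) c w)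
  | count-∷ (_<ᵇ b) c w | count-∷ (_<ᵇ c) b w
  | <ᵇ-true {b} {c} (<-≤-trans (<ᵇ-true⁻ b x b<x) (<ᵇ-false⁻ c x c≥x))
  | <ᵇ-false {c} {b} (<⇒≤ (<-≤-trans (<ᵇ-true⁻ b x b<x) (<ᵇ-false⁻ c x c≥x))) =
  arith (count (_<ᵇ b) w) (count (_<ᵇ c) w) (inv w) _ (count (_<ᵇ x) w) (inv-carry-large x c w c≥x)
  where
  arith : ∀ a b c d e → d + e ≡ b + c → a + d + suc e ≡ suc (b + (a + c))
  arith a b c d e h = trans (lem₁ a d e) (trans (cong (λ t → suc (a + t)) h) (lem₂ a b c))
    where
    lem₁ : ∀ a d e → a + d + suc e ≡ suc (a + (d + e))
    lem₁ = solve-∀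
    lem₂ : ∀ a b c → suc (a + (b + c)) ≡ suc (b + (a + c))
    lem₂ = solve-∀

sameSide : ℕ → Bool → ℕ → Bool
sameSide x true  b = b <ᵇ x
sameSide x false b = not (b <ᵇ x)

sameSide-refl : ∀ x b → sameSide x (b <ᵇ x) b ≡ true
sameSide-refl x b with b <ᵇ x in e
... | true  = e
... | false = cong not e

rotate : ℕ → List ℕ → List ℕ
rotate x []      = []
rotate x (c ∷ w) = carry (sameSide x (c <ᵇ x)) c w

foata : List ℕ → List ℕ
foata []      = []
foata (x ∷ w) = x ∷ rotate x (foata w)

rotate-↭ : ∀ x w → rotate x w ↭ w
rotate-↭ x []      = ↭-refl
rotate-↭ x (c ∷ w) = carry-↭ (sameSide x (c <ᵇ x)) c w

foata-↭ : ∀ w → foata w ↭ w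
foata-↭ []      = ↭-refl
foata-↭ (x ∷ w) = prep x (↭-trans (rotate-↭ x (foata w)) (foata-↭ w))

-- The side was chosen by a letter whose place the rotation forgets. The last letter of the result
-- remembers it, which makes the rotation invertible.
rotate-last : ∀ x c w → (lastOr 0 (rotate x (c ∷ w)) <ᵇ x) ≡ (c <ᵇ x)
rotate-last x c w with c <ᵇ x in e
... | true  = carry-last (_<ᵇ x) 0 c w e
... | false = trans (sym (not-involutive _)) (cong not (carry-last (not ∘ (_<ᵇ x)) 0 c w (cong not e)))

rotate-injective : ∀ x u w → rotate x u ≡ rotate x w → u ≡ w
rotate-injective x []      []      e = refl
rotate-injective x []      (c ∷ w) e = ⊥-elim (¬x∷xs↭[] (↭-trans (↭-sym (rotate-↭ x (c ∷ w))) (↭-reflexive (sym e))))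
rotate-injective x (c ∷ u) []      e = ⊥-elim (¬x∷xs↭[] (↭-trans (↭-sym (rotate-↭ x (c ∷ u))) (↭-reflexive e)))
rotate-injective x (c ∷ u) (d ∷ w) e = carry-injective _ u w (sameSide-refl x c)
  (subst (λ b → sameSide x b d ≡ true) (sym side) (sameSide-refl x d))
  (trans e (cong (λ b → carry (sameSide x b) d w) (sym side)))
  where
  side : (c <ᵇ x) ≡ (d <ᵇ x)
  side = trans (sym (rotate-last x c u)) (trans (cong (λ v → lastOr 0 v <ᵇ x) e) (rotate-last x d w))

foata-injective : ∀ u w → foata u ≡ foata w → u ≡ w
foata-injective []      []      e = refl
foata-injective (x ∷ u) (y ∷ w) e with ∷-injectiveˡ e
... | refl = cong (x ∷_) (foata-injective u w (rotate-injective x _ _ (∷-injectiveʳ e)))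

-- The letter `x` in front contributes one inversion for each letter below it. If `c` is below `x`,
-- the rotation adds those of `w` not below `x`, so that all letters are counted; otherwise it
-- removes exactly what `x` contributes.
inv-rotate : ∀ x c w → inv (x ∷ rotate x (c ∷ w)) ≡ bit (c <ᵇ x) * length (c ∷ w) + inv (c ∷ w)
inv-rotate x c w with c <ᵇ x in e
... | true  rewrite count-↭ (_<ᵇ x) (carry-↭ (_<ᵇ x) c w) | count-∷ (_<ᵇ x) c w | e | inv-carry-small x c w e
  | sym (count-split (_<ᵇ x) w) = arith (count (_<ᵇ x) w) (inv (c ∷ w)) (count (not ∘ (_<ᵇ x)) w)
  where
  arith : ∀ a b c → suc (a + (b + c)) ≡ suc (a + c + 0 + b)
  arith = solve-∀
... | false rewrite count-↭ (_<ᵇ x) (carry-↭ (not ∘ (_<ᵇ x)) c w) | count-∷ (_<ᵇ x) c w | e =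
  trans (+-comm (count (_<ᵇ x) w) _) (inv-carry-large x c w e)

-- `foata` keeps the first letter in place, so the test made by the rotation is the descent test of
-- the original word.
inv-foata : ∀ w → inv (foata w) ≡ rmaj w
inv-foata []          = refl
inv-foata (x ∷ [])    = refl
inv-foata (x ∷ y ∷ w) = trans (inv-rotate x y (rotate y (foata w)))
  (cong₂ (λ l i → bit (y <ᵇ x) * l + i) (↭-length (foata-↭ (y ∷ w))) (inv-foata (y ∷ w)))

-- Rotating the letters behind `x` is invisible to the fold in two situations: `x` settles the
-- result whatever follows, or one side of `x` acts as the identity and `carry-foldr` applies.
foata-foldr : ∀ {R : Set} (s : ℕ → R → R) (z : R) →
  (∀ x → (∀ r r′ → s x r ≡ s x r′) ⊎ (∀ y → y < x → ∀ r → s y r ≡ r) ⊎ (∀ y → x ≤ y → ∀ r → s y r ≡ r)) →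
  ∀ w → foldr s z (foata w) ≡ foldr s z w
foata-foldr s z h []      = refl
foata-foldr s z h (x ∷ w) with h x
... | inj₁ const  = const _ _
... | inj₂ inert = cong (s x) (trans (go (foata w)) (foata-foldr s z h w))
  where
  inert′ : ∀ b → (∀ y → sameSide x b y ≡ true → ∀ r → s y r ≡ r) ⊎ (∀ y → sameSide x b y ≡ false → ∀ r → s y r ≡ r)
  inert′ true  = Sum.map (λ i y e → i y (<ᵇ-true⁻ y x e)) (λ i y e → i y (<ᵇ-false⁻ y x e)) inert
  inert′ false = Sum.swap (Sum.map (λ i y e → i y (<ᵇ-true⁻ y x (not-injective e))) (λ i y e → i y (<ᵇ-false⁻ y x (not-injective e))) inert)
  go : ∀ u → foldr s z (rotate x u) ≡ foldr s z u
  go []      = refl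
  go (c ∷ u) = carry-foldr (sameSide x (c <ᵇ x)) s z (inert′ (c <ᵇ x)) c u (sameSide-refl x c)

-- Descents and left-to-right minima of the inverse

-- Statistics of the inverse are rewritten as right folds over the word itself, the form that
-- `foata-foldr` accepts.
beforeStep : ℕ → ℕ → ℕ → Bool → Bool
beforeStep a b x r = if a ≡ᵇ x then true else (if b ≡ᵇ x then false else r)

before : ℕ → ℕ → List ℕ → Bool
before a b = foldr (beforeStep a b) false

-- The fold built on this starts from `true`, so a value absent from the word may pass as a minimum;
-- `MinimaChain` asks for membership separately.
minimumStep : ℕ → ℕ → Bool → Bool
minimumStep i x r = if i ≡ᵇ x then true else (if x <ᵇ i then false else r)

leftToRightMinimum : ℕ → List ℕ → Bool
leftToRightMinimum i = foldr (minimumStep i) true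

position-before : ∀ {a b w} → a ∈ w → b ∈ w → a ≢ b → (position a w <ᵇ position b w) ≡ before a b w
position-before {a} {b} {x ∷ w} a∈ b∈ a≢b with a ≡ᵇ x in ax | b ≡ᵇ x in bx
... | true  | true  = ⊥-elim (a≢b (trans (≡ᵇ⇒≡ a x (true-T ax)) (sym (≡ᵇ⇒≡ b x (true-T bx)))))
position-before {a} {b} {x ∷ w} a∈ (here refl) a≢b | _ | false = ⊥-elim (case trans (sym (≡ᵇ-true {b} refl)) bx of λ ())
position-before {a} {b} {x ∷ w} (here refl) b∈ a≢b | false | _ = ⊥-elim (case trans (sym (≡ᵇ-true {a} refl)) ax of λ ())
position-before {a} {b} {x ∷ w} a∈ (there b∈) a≢b | true | false with position-∈ b∈
... | j , _ , p , _ rewrite p = refl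
position-before {a} {b} {x ∷ w} (there a∈) b∈ a≢b | false | true with position-∈ a∈
... | i , _ , p , _ rewrite p = refl
position-before {a} {b} {x ∷ w} (there a∈) (there b∈) a≢b | false | false with position-∈ a∈ | position-∈ b∈ | position-before a∈ b∈ a≢b
... | i , _ , p , _ | j , _ , q , _ | e rewrite p | q = e

before-minimum : ∀ i w → suc i ∈ w → All (1 ≤_) w →
  all (λ j → before (suc i) j w) (interval 1 i) ≡ leftToRightMinimum (suc i) w
before-minimum i (x ∷ w) i∈ (1≤x ∷ pos) with suc i ≡ᵇ x in ix
... | true  = all-true (interval 1 i) λ _ → refl
before-minimum i (x ∷ w) (here refl) (1≤x ∷ pos) | false = ⊥-elim (case trans (sym (≡ᵇ-true {suc i} refl)) ix of λ ())
before-minimum i (x ∷ w) (there i∈)  (1≤x ∷ pos) | false with x <ᵇ suc i in xi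
-- A letter below i+1 that is met first is itself a failing `j`; positivity places it in the
-- interval.
... | true  = bool-≡ (λ t → false-T x (all-true⁻ (interval 1 i) (T-true t) (∈-interval⁺ 1 i 1≤x (s≤s⁻¹ (<ᵇ-true⁻ x (suc i) xi))))) ⊥-elim
  where
  false-T : ∀ x → (if x ≡ᵇ x then false else before (suc i) x w) ≡ true → T false
  false-T x e rewrite ≡ᵇ-true {x} refl = true-T e
... | false = trans (all-cong (interval 1 i) λ j∈ → skip (∈-interval⁻ 1 i j∈)) (before-minimum i w i∈ pos)
  where
  skip : ∀ {j} → 1 ≤ j × j ≤ i → (if j ≡ᵇ x then false else before (suc i) j w) ≡ before (suc i) j w
  skip {j} (_ , j≤i) rewrite ≡ᵇ-false {j} {x} (<⇒≢ (≤-trans (s≤s j≤i) (<ᵇ-false⁻ x (suc i) xi))) = refl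

-- No value lies strictly between i and i+1. Hence any other `x` has both on the same side and its
-- other side is inert, while i and i+1 themselves settle the fold.
before-foata : ∀ i w → before (suc i) i (foata w) ≡ before (suc i) i w
before-foata i = foata-foldr (beforeStep (suc i) i) false cases
  where
  inert : ∀ {y} → suc i ≢ y → i ≢ y → ∀ r → beforeStep (suc i) i y r ≡ r
  inert p q r rewrite ≡ᵇ-false p | ≡ᵇ-false q = refl
  cases : ∀ x → (∀ r r′ → beforeStep (suc i) i x r ≡ beforeStep (suc i) i x r′)
    ⊎ (∀ y → y < x → ∀ r → beforeStep (suc i) i y r ≡ r) ⊎ (∀ y → x ≤ y → ∀ r → beforeStep (suc i) i y r ≡ r)
  cases x with <-cmp x i
  ... | tri< x<i _ _ = inj₂ (inj₁ λ y y<x → inert (>⇒≢ (<-trans (<-trans y<x x<i) (n<1+n i))) (>⇒≢ (<-trans y<x x<i)))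
  ... | tri≈ _ refl _ = inj₁ (λ r r′ → const)
    where
    const : ∀ {r r′} → beforeStep (suc i) i i r ≡ beforeStep (suc i) i i r′
    const rewrite ≡ᵇ-false {suc i} {i} (>⇒≢ (n<1+n i)) | ≡ᵇ-true {i} refl = refl
  ... | tri> _ _ i<x with m≤n⇒m<n∨m≡n i<x
  ...   | inj₁ i+1<x = inj₂ (inj₂ λ y x≤y → inert (<⇒≢ (<-≤-trans i+1<x x≤y)) (<⇒≢ (<-≤-trans i<x x≤y)))
  ...   | inj₂ refl = inj₁ (λ r r′ → const)
    where
    const : ∀ {r r′} → beforeStep (suc i) i (suc i) r ≡ beforeStep (suc i) i (suc i) r′
    const rewrite ≡ᵇ-true {suc i} refl = refl

-- Letters above `i` are skipped by the fold and letters up to `i` settle it.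
leftToRightMinimum-foata : ∀ i w → leftToRightMinimum i (foata w) ≡ leftToRightMinimum i w
leftToRightMinimum-foata i = foata-foldr (minimumStep i) true cases
  where
  cases : ∀ x → (∀ r r′ → minimumStep i x r ≡ minimumStep i x r′)
    ⊎ (∀ y → y < x → ∀ r → minimumStep i y r ≡ r) ⊎ (∀ y → x ≤ y → ∀ r → minimumStep i y r ≡ r)
  cases x with <-cmp x i
  ... | tri< x<i _ _ = inj₁ (λ r r′ → const)
    where
    const : ∀ {r r′} → minimumStep i x r ≡ minimumStep i x r′
    const rewrite ≡ᵇ-false (>⇒≢ x<i) | <ᵇ-true x<i = refl
  ... | tri≈ _ refl _ = inj₁ (λ r r′ → const)
    where
    const : ∀ {r r′} → minimumStep i i r ≡ minimumStep i i r′
    const rewrite ≡ᵇ-true {i} refl = refl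
  ... | tri> _ _ i<x = inj₂ (inj₂ inert)
    where
    inert : ∀ y → x ≤ y → ∀ r → minimumStep i y r ≡ r
    inert y x≤y r rewrite ≡ᵇ-false (<⇒≢ (<-≤-trans i<x x≤y)) | <ᵇ-false (<⇒≤ (<-≤-trans i<x x≤y)) = refl

foata-perm : ∀ {n w} → IsPerm n w → IsPerm n (foata w)
foata-perm {w = w} = perm-resp-↭ (foata-↭ w)

perm-positive : ∀ {n w} → IsPerm n w → All (1 ≤_) w
perm-positive r = All.tabulate λ x∈ → case ∈-perm⁻ r x∈ of λ { (_ , _ , refl) → s≤s z≤n }

module _ {n : ℕ} {w : List ℕ} (r : IsPerm n w) where

  at-inverse-before : ∀ {i j} → i < n → j < n → i ≢ j →
    (at (inverse w) (suc i) <ᵇ at (inverse w) (suc j)) ≡ before (suc i) (suc j) w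
  at-inverse-before i< j< i≢j = trans (cong₂ _<ᵇ_ (at-inverse r i<) (at-inverse r j<))
    (position-before (perm-∈ r i<) (perm-∈ r j<) (i≢j ∘ suc-injective))

  isDesS-inverse : ∀ {i} → suc i < n → isDesS (inverse w) (suc i) ≡ before (suc (suc i)) (suc i) w
  isDesS-inverse {i} i< = at-inverse-before i< (<-trans (n<1+n i) i<) (>⇒≢ (n<1+n i))

  isDelS-inverse : ∀ {i} → i < n → isDelS (inverse w) (suc i) ≡ leftToRightMinimum (suc i) w
  isDelS-inverse {i} i< = trans (all-cong (interval 1 i) λ j∈ → step (∈-interval⁻ 1 i j∈))
    (before-minimum i w (perm-∈ r i<) (perm-positive r))
    where
    step : ∀ {j} → 1 ≤ j × j ≤ i → (at (inverse w) (suc i) <ᵇ at (inverse w) j) ≡ before (suc i) j w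
    step {suc j} (_ , j<i) = at-inverse-before i< (<-trans j<i i<) (>⇒≢ j<i)

isDesS-inverse-foata : ∀ {n w i} → IsPerm n w → suc i < n →
  isDesS (inverse (foata w)) (suc i) ≡ isDesS (inverse w) (suc i)
isDesS-inverse-foata {w = w} {i} r i< = trans (isDesS-inverse (foata-perm r) i<)
  (trans (before-foata (suc i) w) (sym (isDesS-inverse r i<)))

isDelS-inverse-foata : ∀ {n w i} → IsPerm n w → i < n →
  isDelS (inverse (foata w)) (suc i) ≡ isDelS (inverse w) (suc i)
isDelS-inverse-foata {w = w} {i} r i< = trans (isDelS-inverse (foata-perm r) i<)
  (trans (leftToRightMinimum-foata (suc i) w) (sym (isDelS-inverse r i<)))

desSSubᵇ-cong : ∀ {n u w} D → length u ≡ n → length w ≡ n →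
  (∀ {i} → suc i < n → isDesS u (suc i) ≡ isDesS w (suc i)) → desSSubᵇ u D ≡ desSSubᵇ w D
desSSubᵇ-cong {n} {u} {w} D lu lw h rewrite lu | lw = all-cong (range (n ∸ 1)) λ i∈ → step (∈-range⁻ i∈)
  where
  step : ∀ {i} → (∃ λ k → k < n ∸ 1 × i ≡ suc k) →
    (not (isDesS u i) ∨ memᵇ i D) ≡ (not (isDesS w i) ∨ memᵇ i D)
  step (k , k< , refl) = cong (λ b → not b ∨ memᵇ (suc k) D) (h (<-pred⁻ k<))
    where
    <-pred⁻ : ∀ {k n} → k < n ∸ 1 → suc k < n
    <-pred⁻ {n = suc n} k< = s≤s k<

delSSubᵇ-cong : ∀ {n u w} D → length u ≡ n → length w ≡ n →
  (∀ {i} → i < n → isDelS u (suc i) ≡ isDelS w (suc i)) → delSSubᵇ u D ≡ delSSubᵇ w D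
delSSubᵇ-cong {n} {u} {w} D lu lw h rewrite lu | lw = all-cong (interval 2 n) λ i∈ → step (∈-interval⁻ 2 n i∈)
  where
  step : ∀ {i} → 2 ≤ i × i ≤ n → (not (isDelS u i) ∨ memᵇ i D) ≡ (not (isDelS w i) ∨ memᵇ i D)
  step {suc i} (_ , i<n) = cong (λ b → not b ∨ memᵇ (suc i) D) (h i<n)

-- Equidistribution on the symmetric group

sIndexed : List ℕ → List ℕ → List ℕ → Bool
sIndexed D₁ D₂ π = desSSubᵇ (inverse π) D₁ ∧ delSSubᵇ (inverse π) D₂

sIndexed-foata : ∀ {n w} D₁ D₂ → IsPerm n w → sIndexed D₁ D₂ (foata w) ≡ sIndexed D₁ D₂ w
sIndexed-foata {n} {w} D₁ D₂ r = cong₂ _∧_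
  (desSSubᵇ-cong {u = inverse (foata w)} {inverse w} D₁ (perm-length (inverse-perm (foata-perm r))) (perm-length (inverse-perm r)) (isDesS-inverse-foata r))
  (delSSubᵇ-cong {u = inverse (foata w)} {inverse w} D₂ (perm-length (inverse-perm (foata-perm r))) (perm-length (inverse-perm r)) (isDelS-inverse-foata r))

lenS-foata : ∀ w → lenS (foata w) ≡ rmajS w
lenS-foata w = trans (lenS≡inv (foata w)) (trans (inv-foata w) (sym (rmajS≡rmaj w)))

rmajS-lenS-equidistributed : ∀ n D₁ D₂ k → coeff (SIndex n D₁ D₂) rmajS k ≡ coeff (SIndex n D₁ D₂) lenS k
rmajS-lenS-equidistributed n D₁ D₂ k = begin
  coeff (SIndex n D₁ D₂) rmajS k
    ≡⟨ count-filter (λ π → rmajS π ≡ᵇ k) (sIndexed D₁ D₂) (Sym n) ⟩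
  count (λ π → sIndexed D₁ D₂ π ∧ (rmajS π ≡ᵇ k)) (Sym n)
    ≡⟨ count-cong (Sym n) (λ {π} π∈ → cong₂ (λ b l → b ∧ (l ≡ᵇ k))
         (sym (sIndexed-foata D₁ D₂ (∈-Sym⁻ {n} π∈))) (sym (lenS-foata π))) ⟩
  count (λ π → sIndexed D₁ D₂ (foata π) ∧ (lenS (foata π) ≡ᵇ k)) (Sym n)
    ≡⟨ count-injective (unique-Sym n) (λ π∈ → ∈-Sym⁺ (foata-perm (∈-Sym⁻ {n} π∈)))
         (λ {π} {ρ} _ _ → foata-injective π ρ) (λ π → sIndexed D₁ D₂ π ∧ (lenS π ≡ᵇ k)) ⟩
  count (λ π → sIndexed D₁ D₂ π ∧ (lenS π ≡ᵇ k)) (Sym n)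
    ≡⟨ count-filter (λ π → lenS π ≡ᵇ k) (sIndexed D₁ D₂) (Sym n) ⟨
  coeff (SIndex n D₁ D₂) lenS k ∎
  where open ≡-Reasoning

-- The covering map from permutations of [n+1] to permutations of [n]

-- One pass of bubble sort: the running minimum `m` is carried to the right end and there dropped.
shed : ℕ → List ℕ → List ℕ
shed m []      = []
shed m (b ∷ w) = m ⊔ b ∷ shed (m ⊓ b) w

least : ℕ → List ℕ → ℕ
least m []      = m
least m (b ∷ w) = least (m ⊓ b) w

shedHead : List ℕ → List ℕ
shedHead []      = []
shedHead (b ∷ w) = shed b w

-- Moves the value of each left-to-right minimum to the place of the next one, discarding the last value and the first place.
cover : List ℕ → List ℕ
cover v = map pred (shedHead v)

length-shed : ∀ m w → length (shed m w) ≡ length w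
length-shed m []      = refl
length-shed m (b ∷ w) = cong suc (length-shed (m ⊓ b) w)

shed-↭ : ∀ m w → m ∷ w ↭ least m w ∷ shed m w
shed-↭ m []      = ↭-refl
shed-↭ m (b ∷ w) = ↭-trans (exchange (≤-total m b)) (↭-trans (prep (m ⊔ b) (shed-↭ (m ⊓ b) w)) (swap _ _ ↭-refl))
  where
  exchange : m ≤ b ⊎ b ≤ m → m ∷ b ∷ w ↭ m ⊔ b ∷ m ⊓ b ∷ w
  exchange (inj₁ m≤b) rewrite m≤n⇒m⊔n≡n m≤b | m≤n⇒m⊓n≡m m≤b = swap m b ↭-refl
  exchange (inj₂ b≤m) rewrite m≥n⇒m⊔n≡m b≤m | m≥n⇒m⊓n≡n b≤m = ↭-refl

least-≤-init : ∀ m w → least m w ≤ m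
least-≤-init m []      = ≤-refl
least-≤-init m (b ∷ w) = ≤-trans (least-≤-init (m ⊓ b) w) (m⊓n≤m m b)

least-≤ : ∀ {x} m w → x ∈ m ∷ w → least m w ≤ x
least-≤ m w       (here refl)         = least-≤-init m w
least-≤ m (b ∷ w) (there (here refl)) = ≤-trans (least-≤-init (m ⊓ b) w) (m⊓n≤n m b)
least-≤ m (b ∷ w) (there (there x∈))  = least-≤ (m ⊓ b) w (there x∈)

least-∈ : ∀ m w → least m w ∈ m ∷ w
least-∈ m w = ∈-resp-↭ (↭-sym (shed-↭ m w)) (here refl)

shed-take : ∀ m w k → shed m (take k w) ≡ take k (shed m w)
shed-take m w       zero    = refl
shed-take m []      (suc k) = refl
shed-take m (b ∷ w) (suc k) = cong (m ⊔ b ∷_) (shed-take (m ⊓ b) w k)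

at-shed : ∀ m w {i} → i < length w → at (shed m w) (suc i) ≡ least m (take i w) ⊔ at w (suc i)
at-shed m (b ∷ w) {zero}  _       = refl
at-shed m (b ∷ w) {suc i} (s≤s l) = at-shed (m ⊓ b) w l

module _ {n b : ℕ} {w : List ℕ} (r : IsPerm (suc n) (b ∷ w)) where

  least-perm : least b w ≡ 1
  least-perm = ≤-antisym (least-≤ b w (perm-∈ r z<s)) (case ∈-perm⁻ r (least-∈ b w) of λ { (_ , _ , e) → subst (1 ≤_) (sym e) (s≤s z≤n) })

  shed-perm : shed b w ↭ map suc (range n)
  shed-perm = drop-∷ (↭-trans (↭-reflexive (cong (_∷ shed b w) (sym least-perm)))
    (↭-trans (↭-sym (shed-↭ b w)) (↭-trans (IsPerm.↭-range r) (↭-reflexive (range-suc n)))))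

  cover-∷-perm : IsPerm n (cover (b ∷ w))
  cover-∷-perm = perm (↭-trans (↭-map pred shed-perm) (↭-reflexive (trans (sym (map-∘ (range n))) (map-id (range n)))))

  suc-cover : map suc (cover (b ∷ w)) ≡ shed b w
  suc-cover = trans (sym (map-∘ (shed b w))) (trans (map-cong-local (All.tabulate λ x∈ → positive (∈-map⁻ suc (∈-resp-↭ shed-perm x∈)))) (map-id (shed b w)))
    where
    positive : ∀ {x} → (∃ λ y → y ∈ range n × x ≡ suc y) → suc (pred x) ≡ x
    positive (_ , _ , refl) = refl

  suc-at-cover : ∀ {i} → i < n → suc (at (cover (b ∷ w)) (suc i)) ≡ at (shed b w) (suc i)
  suc-at-cover {i} i< = trans (sym (at-map suc (cover (b ∷ w)) (subst (i <_) (sym (perm-length cover-∷-perm)) i<)))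
    (cong (λ v → at v (suc i)) suc-cover)

cover-perm : ∀ {n v} → IsPerm (suc n) v → IsPerm n (cover v)
cover-perm {v = []}    r = ⊥-elim (case perm-length r of λ ())
cover-perm {v = b ∷ w} r = cover-∷-perm r

-- The minimum of the first p+1 entries, given by its properties so that it can be compared for `v`
-- and its inverse without reference to the recursion of `least`.
PrefixMinimum : List ℕ → ℕ → ℕ → Set
PrefixMinimum v p m = (∃ λ i → i ≤ p × at v (suc i) ≡ m) × (∀ {i} → i ≤ p → m ≤ at v (suc i))

∈-take⁻ : ∀ {x} k w → x ∈ take k w → ∃ λ i → i < k × at w (suc i) ≡ x
∈-take⁻ (suc k) (y ∷ w) (here refl) = 0 , z<s , refl
∈-take⁻ (suc k) (y ∷ w) (there x∈) with ∈-take⁻ k w x∈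
... | i , l , e = suc i , s≤s l , e

at-∈-take : ∀ k w {i} → i < k → k ≤ length w → at w (suc i) ∈ take k w
at-∈-take (suc k) (y ∷ w) {zero}  _       _       = here refl
at-∈-take (suc k) (y ∷ w) {suc i} (s≤s l) (s≤s m) = there (at-∈-take k w l m)

cover-at : ∀ {n v p} → IsPerm (suc n) v → p < n →
  ∃ λ m → PrefixMinimum v p m × suc (at (cover v) (suc p)) ≡ m ⊔ at v (suc (suc p))
cover-at {n} {[]}    r p<n = ⊥-elim (case perm-length r of λ ())
cover-at {n} {b ∷ w} {p} r p<n = m , (attained , λ i≤p → least-≤ b (take p w) (at-∈-take (suc p) (b ∷ w) (s≤s i≤p) (s≤s (<⇒≤ p<))))
  , trans (suc-at-cover r p<n) (at-shed b w p<)
  where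
  m = least b (take p w)
  p< : p < length w
  p< = subst (p <_) (sym (suc-injective (perm-length r))) p<n
  attained : ∃ λ i → i ≤ p × at (b ∷ w) (suc i) ≡ m
  attained with ∈-take⁻ (suc p) (b ∷ w) (least-∈ b (take p w))
  ... | i , i< , e = i , s≤s⁻¹ i< , e

-- The graph of cover v consists of the (i , j) such that either v (i+1) = j+1 and v meets the box [i] × [j],
-- or v misses that box, v (i+1) ≤ j and v⁻¹ (j+1) ≤ i; this condition is symmetric under inversion.
cover-inverse-at : ∀ {n v i j} → IsPerm (suc n) v → i < n → j < n →
  at (cover v) (suc i) ≡ suc j → at (cover (inverse v)) (suc j) ≡ suc i
cover-inverse-at {n} {v} {i} {j} r i< j< e with cover-at r i< | cover-at (inverse-perm r) j<
... | m , ((k , k≤i , vk) , min) , c | m′ , ((l , l≤j , ul) , min′) , c′ = suc-injective (trans c′ (main (<-≤-connex (at v (suc (suc i))) m)))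
  where
  y = at v (suc (suc i))
  top : m ⊔ y ≡ suc (suc j)
  top = trans (sym c) (cong suc e)
  k< : k < suc n
  k< = ≤-<-trans k≤i (<-trans i< (n<1+n n))
  l< : l < suc n
  l< = ≤-<-trans l≤j (<-trans j< (n<1+n n))
  main : y < m ⊎ m ≤ y → m′ ⊔ at (inverse v) (suc (suc j)) ≡ suc (suc i)
  main (inj₂ m≤y) = trans (cong (m′ ⊔_) uy) (m≤n⇒m⊔n≡n (bound (perm-at r k<)))
    where
    y≡ : y ≡ suc (suc j)
    y≡ = trans (sym (m≤n⇒m⊔n≡n m≤y)) top
    uy : at (inverse v) (suc (suc j)) ≡ suc (suc i)
    uy = at-inverse-eq r (s≤s i<) (s≤s j<) y≡
    bound : (∃ λ q → q < suc n × at v (suc k) ≡ suc q) → m′ ≤ suc (suc i)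
    bound (q , q< , vq) = ≤-trans (min′ (s≤s⁻¹ (≤∧≢⇒< q≤ q≢)))
      (≤-trans (≤-reflexive (at-inverse-eq r k< q< vq)) (s≤s (≤-trans k≤i (n≤1+n i))))
      where
      q≤ : q ≤ suc j
      q≤ = s≤s⁻¹ (subst₂ _≤_ (trans (sym vk) vq) y≡ m≤y)
      q≢ : q ≢ suc j
      q≢ refl = <⇒≢ (s≤s k≤i) (suc-injective (trans (sym (at-inverse-eq r k< q< vq)) uy))
  main (inj₁ y<m) with perm-at r (s≤s i<) | inverse-at r l<
  ... | y₀ , y₀< , vy | q , q< , uq , vq = trans (cong₂ _⊔_ m′≡ uk) (m≥n⇒m⊔n≡m (s≤s (≤-trans k≤i (n≤1+n i))))
    where
    m≡ : m ≡ suc (suc j)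
    m≡ = trans (sym (m≥n⇒m⊔n≡m (<⇒≤ y<m))) top
    uk : at (inverse v) (suc (suc j)) ≡ suc k
    uk = at-inverse-eq r k< (s≤s j<) (trans vk m≡)
    m′≤ : m′ ≤ suc (suc i)
    m′≤ = ≤-trans (min′ (s≤s⁻¹ (s≤s⁻¹ (subst₂ _<_ vy m≡ y<m)))) (≤-reflexive (at-inverse-eq r (s≤s i<) y₀< vy))
    i<q : i < q
    i<q = ≰⇒> λ q≤i → <⇒≱ (s≤s (s≤s l≤j)) (subst₂ _≤_ m≡ vq (min q≤i))
    m′≡ : m′ ≡ suc (suc i)
    m′≡ = ≤-antisym m′≤ (≤-trans (s≤s i<q) (≤-reflexive (trans (sym uq) ul)))

cover-inverse : ∀ {n v} → IsPerm (suc n) v → inverse (cover v) ≡ cover (inverse v)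
cover-inverse {n} {v} r = at-ext _ _
  (trans (perm-length (inverse-perm (cover-perm r))) (sym (perm-length (cover-perm (inverse-perm r)))))
  λ {j} j< → step j (subst (j <_) (perm-length (inverse-perm (cover-perm r))) j<)
  where
  step : ∀ j → j < n → at (inverse (cover v)) (suc j) ≡ at (cover (inverse v)) (suc j)
  step j j< with inverse-at (cover-perm r) j<
  ... | i , i< , u , e = trans u (sym (cover-inverse-at r i< j< e))

-- Almost left-to-right minima and the covering map

count-zero : (p : A → Bool) (xs : List A) → (∀ {x} → x ∈ xs → p x ≡ false) → count p xs ≡ 0
count-zero p []       h = refl
count-zero p (x ∷ xs) h = trans (count-∷ p x xs) (cong₂ (λ b c → bit b + c) (h (here refl)) (count-zero p xs (h ∘ there)))

count-zero⁻ : (p : A → Bool) (xs : List A) → count p xs ≡ 0 → ∀ {x} → x ∈ xs → p x ≡ false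
count-zero⁻ p (y ∷ xs) e x∈ with p y in py
count-zero⁻ p (y ∷ xs) e (here refl) | false = py
count-zero⁻ p (y ∷ xs) e (there x∈)  | false = count-zero⁻ p xs e x∈

-- The word `b ∷ u` is a rearrangement of its least letter and the shed letters. If `x` does not
-- exceed the least letter, both sides are true. Otherwise that letter is the one smaller letter
-- allowed, and all shed letters have to exceed `x`.
count≤1-shed : ∀ x b u → Unique (b ∷ u) → x ∉ b ∷ u →
  (count (_<ᵇ x) (b ∷ u) ≤ᵇ 1) ≡ all (λ y → least b u ⊔ x <ᵇ y) (shed b u)
count≤1-shed x b u uniq x∉ = case <-≤-connex l x of λ where
    (inj₂ x≤l) → trans (cong (_≤ᵇ 1) (count-zero (_<ᵇ x) (b ∷ u) λ y∈ → <ᵇ-false (≤-trans x≤l (least-≤ b u y∈))))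
      (sym (all-true s λ {y} y∈ → <ᵇ-true (subst (_< y) (sym (m≥n⇒m⊔n≡m x≤l)) (least< y∈))))
    (inj₁ l<x) → trans (cong (_≤ᵇ 1) (trans (count-↭ (_<ᵇ x) (shed-↭ b u)) (trans (count-∷ (_<ᵇ x) l s)
        (cong (λ c → bit c + count (_<ᵇ x) s) (<ᵇ-true l<x)))))
      (trans (bool-≡
        (λ t → true-T (all-true s λ {y} y∈ → <ᵇ-true (≤∧≢⇒< (<ᵇ-false⁻ y x (count-zero⁻ (_<ᵇ x) s (n<1⇒n≡0 (<ᵇ⇒< _ 1 t)) y∈))
          (λ { refl → x∉ (∈-resp-↭ (↭-sym (shed-↭ b u)) (there y∈)) }))))
        (λ t → <⇒<ᵇ (s≤s (≤-reflexive (count-zero (_<ᵇ x) s λ {y} y∈ → <ᵇ-false (<⇒≤ (<ᵇ-true⁻ x y (all-true⁻ s (T-true t) y∈))))))))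
        (all-cong s λ {y} _ → cong (_<ᵇ y) (sym (m≤n⇒m⊔n≡n (<⇒≤ l<x)))))
  where
  l = least b u
  s = shed b u
  least< : ∀ {y} → y ∈ s → l < y
  least< y∈ with Unique-resp-↭ (shed-↭ b u) uniq
  ... | l≢ ∷ _ = ≤∧≢⇒< (least-≤ b u (∈-resp-↭ (↭-sym (shed-↭ b u)) (there y∈))) λ { refl → ∉-All l≢ y∈ }

isDelA-cover : ∀ {n v p} → IsPerm (suc n) v → p < n → isDelA v (suc (suc p)) ≡ isDelS (cover v) (suc p)
isDelA-cover {n} {[]}    r p<n = ⊥-elim (case perm-length r of λ ())
isDelA-cover {n} {b ∷ w} {p} r p<n = begin
  count (λ j → at v j <ᵇ x) (interval 1 (suc p)) ≤ᵇ 1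
    ≡⟨ cong (_≤ᵇ 1) (sym (count-map (_<ᵇ x) (at v) (interval 1 (suc p)))) ⟩
  count (_<ᵇ x) (map (at v) (interval 1 (suc p))) ≤ᵇ 1
    ≡⟨ cong (λ u → count (_<ᵇ x) u ≤ᵇ 1) (map-at-interval v (suc p) (s≤s (<⇒≤ p<))) ⟩
  count (_<ᵇ x) (b ∷ take p w) ≤ᵇ 1
    ≡⟨ count≤1-shed x b (take p w) (Unique.take⁺ (suc p) (perm-unique r)) x∉ ⟩
  all (λ y → least b (take p w) ⊔ x <ᵇ y) (shed b (take p w))
    ≡⟨ cong₂ (λ z u → all (z <ᵇ_) u) (sym (at-shed b w p<)) (trans (shed-take b w p)
         (sym (map-at-interval s p (≤-trans (<⇒≤ p<) (≤-reflexive (sym (length-shed b w))))))) ⟩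
  all (at s (suc p) <ᵇ_) (map (at s) (interval 1 p))
    ≡⟨ all-map _ (at s) (interval 1 p) ⟩
  all (λ j → at s (suc p) <ᵇ at s j) (interval 1 p)
    ≡⟨ all-cong (interval 1 p) (λ j∈ → step (∈-interval⁻ 1 p j∈)) ⟩
  isDelS (cover v) (suc p) ∎
  where
  open ≡-Reasoning
  v = b ∷ w
  s = shed b w
  x = at w (suc p)
  p< : p < length w
  p< = subst (p <_) (sym (suc-injective (perm-length r))) p<n
  x∉ : x ∉ b ∷ take p w
  x∉ x∈ with ∈-take⁻ (suc p) v x∈
  ... | i , i< , e = <⇒≢ i< (at-injective (perm-unique r) (<-trans i< (s≤s p<)) (s≤s p<) e)
  step : ∀ {j} → 1 ≤ j × j ≤ p → (at s (suc p) <ᵇ at s j) ≡ (at (cover v) (suc p) <ᵇ at (cover v) j)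
  step {suc j} (_ , j<p) = cong₂ _<ᵇ_ (sym (suc-at-cover r p<n)) (sym (suc-at-cover r (<-trans j<p p<n)))

-- Adjacent transpositions and the generators of the alternating group

-- Multiplication by s_{j+1} on the right.
exchange : ℕ → List ℕ → List ℕ
exchange zero    (x ∷ y ∷ w) = y ∷ x ∷ w
exchange (suc j) (x ∷ w)     = x ∷ exchange j w
exchange _       w           = w

transpose : ℕ → ℕ → ℕ
transpose j k = if k ≡ᵇ suc j then suc (suc j) else (if k ≡ᵇ suc (suc j) then suc j else k)

exchange-↭ : ∀ j w → exchange j w ↭ w
exchange-↭ zero    []          = ↭-refl
exchange-↭ zero    (x ∷ [])    = ↭-refl
exchange-↭ zero    (x ∷ y ∷ w) = swap y x ↭-refl
exchange-↭ (suc j) []          = ↭-refl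
exchange-↭ (suc j) (x ∷ w)     = prep x (exchange-↭ j w)

exchange-involutive : ∀ j w → exchange j (exchange j w) ≡ w
exchange-involutive zero    []          = refl
exchange-involutive zero    (x ∷ [])    = refl
exchange-involutive zero    (x ∷ y ∷ w) = refl
exchange-involutive (suc j) []          = refl
exchange-involutive (suc j) (x ∷ w)     = cong (x ∷_) (exchange-involutive j w)

length-exchange : ∀ j w → length (exchange j w) ≡ length w
length-exchange j w = ↭-length (exchange-↭ j w)

exchange-perm : ∀ {n w} j → IsPerm n w → IsPerm n (exchange j w)
exchange-perm {w = w} j = perm-resp-↭ (exchange-↭ j w)

transpose-suc : ∀ j k → transpose (suc j) (suc k) ≡ suc (transpose j k)
transpose-suc j k with k ≡ᵇ suc j | k ≡ᵇ suc (suc j)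
... | true  | _     = refl
... | false | true  = refl
... | false | false = refl

transpose-positive : ∀ j k → ∃ λ l → transpose j (suc k) ≡ suc l
transpose-positive j k with suc k ≡ᵇ suc j | suc k ≡ᵇ suc (suc j)
... | true  | _     = _ , refl
... | false | true  = _ , refl
... | false | false = _ , refl

transpose-left : ∀ j → transpose j (suc j) ≡ suc (suc j)
transpose-left j rewrite ≡ᵇ-true {j} refl = refl

transpose-right : ∀ j → transpose j (suc (suc j)) ≡ suc j
transpose-right j rewrite ≡ᵇ-false {suc j} {j} (>⇒≢ (n<1+n j)) | ≡ᵇ-true {j} refl = refl

transpose-other : ∀ {j k} → k ≢ suc j → k ≢ suc (suc j) → transpose j k ≡ k
transpose-other {j} {k} p q rewrite ≡ᵇ-false p | ≡ᵇ-false q = refl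

transpose-< : ∀ {j k m} → suc j < m → k < m → ∃ λ l → l < m × transpose j (suc k) ≡ suc l
transpose-< {j} {k} j< k< with suc k ≡ᵇ suc j | suc k ≡ᵇ suc (suc j)
... | true  | _     = _ , j< , refl
... | false | true  = _ , <-trans (n<1+n j) j< , refl
... | false | false = _ , k< , refl

at-exchange : ∀ j w k → suc j < length w → at (exchange j w) k ≡ at w (transpose j k)
at-exchange zero    (x ∷ y ∷ w) zero                l = refl
at-exchange zero    (x ∷ y ∷ w) (suc zero)          l = refl
at-exchange zero    (x ∷ y ∷ w) (suc (suc zero))    l = refl
at-exchange zero    (x ∷ y ∷ w) (suc (suc (suc k))) l = refl
at-exchange zero    (x ∷ [])    k                   (s≤s ())
at-exchange (suc j) (x ∷ w)     zero                l = refl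
at-exchange (suc j) (x ∷ w)     (suc zero)          l = refl
at-exchange (suc j) (x ∷ w)     (suc (suc k))       (s≤s l) with transpose-positive j k
... | m , e = trans (at-exchange j w (suc k) l) (trans (cong (at w) e)
  (sym (cong (at (x ∷ w)) (trans (transpose-suc j (suc k)) (cong suc e)))))

sPerm-exchange : ∀ {m j} → suc j < m → sPerm m (suc j) ≡ exchange j (range m)
sPerm-exchange {m} {j} j< = at-ext _ _ (trans (length-map (transpose j) (range m)) (sym (length-exchange j (range m)))) λ {i} i< →
  step i (subst (i <_) (trans (length-map (transpose j) (range m)) (length-range m)) i<)
  where
  step : ∀ i → i < m → at (sPerm m (suc j)) (suc i) ≡ at (exchange j (range m)) (suc i)
  step i i< with transpose-< j< i<
  ... | l , l< , e = trans (at-map-range (transpose j) i<) (trans e (sym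
    (trans (at-exchange j (range m) (suc i) (subst (suc j <_) (sym (length-range m)) j<)) (trans (cong (at (range m)) e) (at-range l<)))))

compose-sPerm : ∀ {m j} w → length w ≡ m → suc j < m → compose w (sPerm m (suc j)) ≡ exchange j w
compose-sPerm {m} {j} w lw j< = at-ext _ _ (trans len (sym (trans (length-exchange j w) lw))) λ {i} i< →
  step i (subst (i <_) len i<)
  where
  len : length (compose w (sPerm m (suc j))) ≡ m
  len = trans (length-map (at w) (sPerm m (suc j))) (trans (length-map (transpose j) (range m)) (length-range m))
  step : ∀ i → i < m → at (compose w (sPerm m (suc j))) (suc i) ≡ at (exchange j w) (suc i)
  step i i< = trans (at-map (at w) (sPerm m (suc j)) (subst (i <_) (sym (trans (length-map (transpose j) (range m)) (length-range m))) i<))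
    (trans (cong (at w) (at-map-range (transpose j) i<)) (sym (at-exchange j w (suc i) (subst (suc j <_) (sym lw) j<))))

at-compose : ∀ σ τ k → at (compose σ τ) k ≡ at σ (at τ k)
at-compose σ []      k             = sym (at-zero σ)
at-compose σ (x ∷ τ) zero          = sym (at-zero σ)
at-compose σ (x ∷ τ) (suc zero)    = refl
at-compose σ (x ∷ τ) (suc (suc k)) = at-compose σ τ (suc k)

compose-assoc : ∀ σ τ ρ → compose (compose σ τ) ρ ≡ compose σ (compose τ ρ)
compose-assoc σ τ ρ = trans (map-cong (at-compose σ τ) ρ) (map-∘ ρ)

compose-identityʳ : ∀ {m} w → length w ≡ m → compose w (idPerm m) ≡ w
compose-identityʳ {m} w lw = at-ext _ _ (trans len (sym lw)) λ {i} i< → at-map-range (at w) (subst (i <_) len i<)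
  where
  len : length (compose w (idPerm m)) ≡ m
  len = trans (length-map (at w) (range m)) (length-range m)

compose-identityˡ : ∀ {m w} → IsPerm m w → compose (idPerm m) w ≡ w
compose-identityˡ {m} {w} r = trans (map-cong-local (All.tabulate λ x∈ → fixed (∈-perm⁻ r x∈))) (map-id w)
  where
  fixed : ∀ {x} → (∃ λ k → k < m × x ≡ suc k) → at (idPerm m) x ≡ x
  fixed (k , k< , refl) = at-range k<

compose-inverse : ∀ {m w} → IsPerm m w → compose w (inverse w) ≡ idPerm m
compose-inverse {m} {w} r = at-ext _ _ (trans len (sym (length-range m))) λ {j} j< → step j (subst (j <_) len j<)
  where
  len : length (compose w (inverse w)) ≡ m
  len = trans (length-map (at w) (inverse w)) (perm-length (inverse-perm r))
  step : ∀ j → j < m → at (compose w (inverse w)) (suc j) ≡ at (idPerm m) (suc j)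
  step j j< with inverse-at r j<
  ... | i , i< , u , e = trans (at-compose w (inverse w) (suc j)) (trans (cong (at w) u) (trans e (sym (at-range j<))))

-- Multiplication by a_{j+1} on the right.
generate : ℕ → List ℕ → List ℕ
generate j w = exchange (suc j) (exchange 0 w)

generate⁻¹ : ℕ → List ℕ → List ℕ
generate⁻¹ j w = exchange 0 (exchange (suc j) w)

generate-generate⁻¹ : ∀ j w → generate j (generate⁻¹ j w) ≡ w
generate-generate⁻¹ j w = trans (cong (exchange (suc j)) (exchange-involutive 0 (exchange (suc j) w))) (exchange-involutive (suc j) w)

generate-perm : ∀ {n w} j → IsPerm n w → IsPerm n (generate j w)
generate-perm j r = exchange-perm (suc j) (exchange-perm 0 r)

generate⁻¹-perm : ∀ {n w} j → IsPerm n w → IsPerm n (generate⁻¹ j w)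
generate⁻¹-perm j r = exchange-perm 0 (exchange-perm (suc j) r)

module _ {n j : ℕ} (j< : suc j < n) where

  compose-aGen : ∀ w → length w ≡ suc n → compose w (aGen n (suc j)) ≡ generate j w
  compose-aGen w lw = trans (sym (compose-assoc w (sPerm (suc n) 1) (sPerm (suc n) (suc (suc j)))))
    (trans (cong (λ u → compose u (sPerm (suc n) (suc (suc j)))) (compose-sPerm w lw (s≤s (≤-<-trans z≤n j<))))
      (compose-sPerm (exchange 0 w) (trans (length-exchange 0 w) lw) (s≤s j<)))

  aGen-generate : aGen n (suc j) ≡ generate j (range (suc n))
  aGen-generate = trans (cong (λ u → compose u (sPerm (suc n) (suc (suc j)))) (sPerm-exchange (s≤s (≤-<-trans z≤n j<))))
    (compose-sPerm (exchange 0 (range (suc n))) (trans (length-exchange 0 (range (suc n))) (length-range (suc n))) (s≤s j<))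

  aGen-perm : IsPerm (suc n) (aGen n (suc j))
  aGen-perm = subst (IsPerm (suc n)) (sym aGen-generate) (generate-perm j (perm ↭-refl))

  -- Write `w` as `generate⁻¹ j w` times the generator, which then cancels against its inverse.
  compose-aGen⁻¹ : ∀ w → length w ≡ suc n → compose w (inverse (aGen n (suc j))) ≡ generate⁻¹ j w
  compose-aGen⁻¹ w lw = begin
    compose w (inverse a)                       ≡⟨ cong (λ u → compose u (inverse a)) (sym (generate-generate⁻¹ j w)) ⟩
    compose (generate j w′) (inverse a)         ≡⟨ cong (λ u → compose u (inverse a)) (sym (compose-aGen w′ lw′)) ⟩
    compose (compose w′ a) (inverse a)          ≡⟨ compose-assoc w′ a (inverse a) ⟩
    compose w′ (compose a (inverse a))          ≡⟨ cong (compose w′) (compose-inverse aGen-perm) ⟩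
    compose w′ (idPerm (suc n))                 ≡⟨ compose-identityʳ w′ lw′ ⟩
    w′ ∎
    where
    open ≡-Reasoning
    a = aGen n (suc j)
    w′ = generate⁻¹ j w
    lw′ : length w′ ≡ suc n
    lw′ = trans (length-exchange 0 (exchange (suc j) w)) (trans (length-exchange (suc j) w) lw)

inv-exchange-ascent : ∀ j w → suc j < length w → at w (suc j) < at w (suc (suc j)) → inv (exchange j w) ≡ suc (inv w)
inv-exchange-ascent zero    (x ∷ [])    (s≤s ()) _
inv-exchange-ascent zero    (x ∷ y ∷ w) l a
  rewrite count-∷ (_<ᵇ y) x w | count-∷ (_<ᵇ x) y w | <ᵇ-true a | <ᵇ-false (<⇒≤ a) =
  arith (count (_<ᵇ y) w) (count (_<ᵇ x) w) (inv w)
  where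
  arith : ∀ a b c → suc (a + (b + c)) ≡ suc (b + (a + c))
  arith = solve-∀
inv-exchange-ascent (suc j) (x ∷ w) (s≤s l) a =
  trans (cong₂ _+_ (count-↭ (_<ᵇ x) (exchange-↭ j w)) (inv-exchange-ascent j w l a)) (+-suc _ (inv w))

inv-exchange-descent : ∀ j w → suc j < length w → at w (suc (suc j)) < at w (suc j) → suc (inv (exchange j w)) ≡ inv w
inv-exchange-descent j w l d = trans (sym (inv-exchange-ascent j (exchange j w) (subst (suc j <_) (sym (length-exchange j w)) l)
    (subst₂ _<_ (sym (trans (at-exchange j w (suc j) l) (cong (at w) (transpose-left j))))
                (sym (trans (at-exchange j w (suc (suc j)) l) (cong (at w) (transpose-right j)))) d)))
  (cong inv (exchange-involutive j w))

-- Parity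

even : ℕ → Bool
even zero    = true
even (suc m) = not (even m)

even-% : ∀ m → (m % 2 ≡ᵇ 0) ≡ even m
even-% zero          = refl
even-% (suc zero)    = refl
even-% (suc (suc m)) = trans (even-% m) (sym (not-involutive (even m)))

even-inv-exchange : ∀ j w → Unique w → suc j < length w → even (inv (exchange j w)) ≡ not (even (inv w))
even-inv-exchange j w u l with <-cmp (at w (suc j)) (at w (suc (suc j)))
... | tri< a _ _ = cong even (inv-exchange-ascent j w l a)
... | tri≈ _ e _ = ⊥-elim (<⇒≢ (n<1+n j) (at-injective u (<-trans (n<1+n j) l) l e))
... | tri> _ _ d = trans (sym (not-involutive _)) (cong not (cong even (inv-exchange-descent j w l d)))

IsEvenPerm : ℕ → List ℕ → Set
IsEvenPerm n w = IsPerm n w × even (inv w) ≡ true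

∈-Alt⁻ : ∀ {n w} → w ∈ Alt n → IsEvenPerm n w
∈-Alt⁻ {n} {w} w∈ with ∈-filterᵇ⁻ (λ π → lenS π % 2 ≡ᵇ 0) {xs = Sym n} w∈
... | w∈′ , e = ∈-Sym⁻ w∈′ , trans (cong even (sym (lenS≡inv w))) (trans (sym (even-% (lenS w))) e)

module _ {n j : ℕ} {w : List ℕ} (j< : suc j < n) where

  generate-even : IsEvenPerm (suc n) w → IsEvenPerm (suc n) (generate j w)
  generate-even (r , e) = generate-perm j r ,
    trans (even-inv-exchange (suc j) (exchange 0 w) (perm-unique (exchange-perm 0 r))
      (subst (suc (suc j) <_) (sym (perm-length (exchange-perm 0 r))) (s≤s j<)))
    (trans (cong not (even-inv-exchange 0 w (perm-unique r) (subst (1 <_) (sym (perm-length r)) (s≤s (≤-<-trans z≤n j<)))))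
      (trans (not-involutive _) e))

  generate⁻¹-even : IsEvenPerm (suc n) w → IsEvenPerm (suc n) (generate⁻¹ j w)
  generate⁻¹-even (r , e) = generate⁻¹-perm j r ,
    trans (even-inv-exchange 0 (exchange (suc j) w) (perm-unique (exchange-perm (suc j) r))
      (subst (1 <_) (sym (perm-length (exchange-perm (suc j) r))) (s≤s (≤-<-trans z≤n j<))))
    (trans (cong not (even-inv-exchange (suc j) w (perm-unique r) (subst (suc (suc j) <_) (sym (perm-length r)) (s≤s j<))))
      (trans (not-involutive _) e))

-- Inversions of the inverse permutation

pairs : ℕ → List (ℕ × ℕ)
pairs m = concatMap (λ i → map (i ,_) (interval (suc i) m)) (range m)

∈-pairs⁻ : ∀ m {i j} → (i , j) ∈ pairs m → ∃₂ λ k l → i ≡ suc k × j ≡ suc l × k < l × l < m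
∈-pairs⁻ m ij∈ with ∈-concatMap⁻ (λ i → map (i ,_) (interval (suc i) m)) (range m) ij∈
... | x , x∈ , ij∈′ with ∈-map⁻ (x ,_) ij∈′ | ∈-range⁻ x∈
...   | y , y∈ , refl | k , k< , refl with ∈-interval⁻ (suc (suc k)) m y∈
...     | s≤s k<l , l< = k , _ , refl , refl , k<l , l<

∈-pairs⁺ : ∀ {m k l} → k < l → l < m → (suc k , suc l) ∈ pairs m
∈-pairs⁺ {m} {k} k<l l< = ∈-concatMap⁺ (λ i → map (i ,_) (interval (suc i) m)) (∈-range⁺ (<-trans k<l l<))
  (∈-map⁺ (suc k ,_) (∈-interval⁺ (suc (suc k)) m (s≤s k<l) l<))

unique-pairs : ∀ m → Unique (pairs m)
unique-pairs m = unique-concatMap (unique-range m)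
  (λ i → Unique.map⁺ (cong proj₂) (Unique.map⁺ (+-cancelˡ-≡ (suc i) _ _) (Unique.upTo⁺ _))) disj
  where
  disj : ∀ {x y z} → z ∈ map (x ,_) (interval (suc x) m) → z ∈ map (y ,_) (interval (suc y) m) → x ≡ y
  disj z∈ z∈′ with ∈-map⁻ _ z∈ | ∈-map⁻ _ z∈′
  ... | _ , _ , refl | _ , _ , refl = refl

isInversion : List ℕ → ℕ × ℕ → Bool
isInversion w (i , j) = at w j <ᵇ at w i

-- Sending an inversion at places i < j to the pair of its values, smaller first, injects the
-- inversions of `w` into those of its inverse. The relation between `w` and `u` is stated on
-- graphs, so that it serves in both directions; the outcome is that even permutations are closed
-- under inversion.
lenS-inverse-≤ : ∀ {n w u} → IsPerm n w → IsPerm n u →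
  (∀ {i j} → i < n → j < n → at w (suc i) ≡ suc j → at u (suc j) ≡ suc i) → lenS w ≤ lenS u
lenS-inverse-≤ {n} {w} {u} r s wu = ≤-trans (≤-reflexive (sym (length-map φ inversions)))
  (unique-⊆-length (unique-map (Unique.filter⁺ (T? ∘ isInversion w) (unique-pairs (length w))) inj) into)
  where
  φ : ℕ × ℕ → ℕ × ℕ
  φ (i , j) = at w j , at w i
  inversions = filterᵇ (isInversion w) (pairs (length w))
  inj : ∀ {x y} → x ∈ inversions → y ∈ inversions → φ x ≡ φ y → x ≡ y
  inj x∈ y∈ e with ∈-pairs⁻ (length w) (proj₁ (∈-filterᵇ⁻ (isInversion w) x∈)) | ∈-pairs⁻ (length w) (proj₁ (∈-filterᵇ⁻ (isInversion w) y∈))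
  ... | k , l , refl , refl , k< , l< | k′ , l′ , refl , refl , k′< , l′< =
    cong₂ (λ a b → suc a , suc b) (at-injective (perm-unique r) (<-trans k< l<) (<-trans k′< l′<) (cong proj₂ e))
      (at-injective (perm-unique r) l< l′< (cong proj₁ e))
  into : ∀ {z} → z ∈ map φ inversions → z ∈ filterᵇ (isInversion u) (pairs (length u))
  into z∈ with ∈-map⁻ φ z∈
  ... | x , x∈ , refl with ∈-filterᵇ⁻ (isInversion w) {xs = pairs (length w)} x∈
  ...   | x∈′ , d with ∈-pairs⁻ (length w) x∈′
  ...     | k , l , refl , refl , k<l , l<′ with perm-at r (<-trans k<l (subst (l <_) (perm-length r) l<′)) | perm-at r (subst (l <_) (perm-length r) l<′)
  ...       | a , a< , wk | b , b< , wl rewrite wk | wl =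
    ∈-filterᵇ⁺ (isInversion u) (∈-pairs⁺ (<ᵇ-true⁻ b a d) (subst (a <_) (sym (perm-length s)) a<))
      (<ᵇ-true (subst₂ _<_ (sym (wu (<-trans k<l l<) a< wk)) (sym (wu l< b< wl)) (s≤s k<l)))
    where
    l< : l < n
    l< = subst (l <_) (perm-length r) l<′

lenS-inverse : ∀ {n w} → IsPerm n w → lenS (inverse w) ≡ lenS w
lenS-inverse {n} {w} r = ≤-antisym (lenS-inverse-≤ (inverse-perm r) r back) (lenS-inverse-≤ r (inverse-perm r) (at-inverse-eq r))
  where
  back : ∀ {i j} → i < n → j < n → at (inverse w) (suc i) ≡ suc j → at w (suc j) ≡ suc i
  back i< j< e with inverse-at r i<
  ... | k , k< , u , v = trans (cong (at w) (trans (sym e) u)) v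

inverse-even : ∀ {n w} → IsEvenPerm n w → IsEvenPerm n (inverse w)
inverse-even {w = w} (r , e) = inverse-perm r ,
  trans (cong even (trans (sym (lenS≡inv (inverse w))) (trans (lenS-inverse r) (lenS≡inv w)))) e

-- The alternating length

shedHead-exchange-0 : ∀ w → shedHead (exchange 0 w) ≡ shedHead w
shedHead-exchange-0 []          = refl
shedHead-exchange-0 (x ∷ [])    = refl
shedHead-exchange-0 (x ∷ y ∷ w) = cong₂ (λ a b → a ∷ shed b w) (⊔-comm y x) (⊓-comm y x)

-- Let b, c be the two letters and m the minimum before them. If at most one of them is below m, the
-- pass treats them independently and its output is exchanged too. If both are below, it emits m and
-- then the larger of b and c in either order, and this is a descent.
shed-exchange : ∀ m j w → Unique (m ∷ w) → suc j < length w →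
  shed m (exchange j w) ≡ exchange j (shed m w)
  ⊎ (shed m (exchange j w) ≡ shed m w × at (shed m w) (suc (suc j)) < at (shed m w) (suc j))
shed-exchange m zero    (b ∷ [])    u (s≤s ())
shed-exchange m zero    (b ∷ c ∷ w) ((m≢b ∷ m≢c ∷ _) ∷ _) l = cases (<-≤-connex m b) (<-≤-connex m c)
  where
  tail : shed (m ⊓ c ⊓ b) w ≡ shed (m ⊓ b ⊓ c) w
  tail = cong (λ z → shed z w) (trans (⊓-assoc m c b) (trans (cong (m ⊓_) (⊓-comm c b)) (sym (⊓-assoc m b c))))
  cases : m < b ⊎ b ≤ m → m < c ⊎ c ≤ m →
    m ⊔ c ∷ (m ⊓ c) ⊔ b ∷ shed (m ⊓ c ⊓ b) w ≡ (m ⊓ b) ⊔ c ∷ m ⊔ b ∷ shed (m ⊓ b ⊓ c) w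
    ⊎ (m ⊔ c ∷ (m ⊓ c) ⊔ b ∷ shed (m ⊓ c ⊓ b) w ≡ m ⊔ b ∷ (m ⊓ b) ⊔ c ∷ shed (m ⊓ b ⊓ c) w × (m ⊓ b) ⊔ c < m ⊔ b)
  cases (inj₁ m<b) _ = inj₁ (cong₂ _∷_ (cong (_⊔ c) (sym (m≤n⇒m⊓n≡m (<⇒≤ m<b))))
    (cong₂ _∷_ (trans (m≤n⇒m⊔n≡n (≤-trans (m⊓n≤m m c) (<⇒≤ m<b))) (sym (m≤n⇒m⊔n≡n (<⇒≤ m<b)))) tail))
  cases (inj₂ b≤m) (inj₁ m<c) = inj₁ (cong₂ _∷_
    (trans (m≤n⇒m⊔n≡n (<⇒≤ m<c)) (sym (m≤n⇒m⊔n≡n (≤-trans (m⊓n≤m m b) (<⇒≤ m<c)))))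
    (cong₂ _∷_ (cong (_⊔ b) (m≤n⇒m⊓n≡m (<⇒≤ m<c))) tail))
  cases (inj₂ b≤m) (inj₂ c≤m) = inj₂
    ( cong₂ _∷_ (trans (m≥n⇒m⊔n≡m c≤m) (sym (m≥n⇒m⊔n≡m b≤m)))
        (cong₂ _∷_ (trans (cong (_⊔ b) (m≥n⇒m⊓n≡n c≤m)) (trans (⊔-comm c b) (cong (_⊔ c) (sym (m≥n⇒m⊓n≡n b≤m))))) tail)
    , subst₂ _<_ (cong (_⊔ c) (sym (m≥n⇒m⊓n≡n b≤m))) (sym (m≥n⇒m⊔n≡m b≤m))
        (⊔-lub (≤∧≢⇒< b≤m (m≢b ∘ sym)) (≤∧≢⇒< c≤m (m≢c ∘ sym))))
shed-exchange m (suc j) (b ∷ w) u (s≤s l) with shed-exchange (m ⊓ b) j w (unique-⊓ u) l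
  where
  unique-⊓ : Unique (m ∷ b ∷ w) → Unique (m ⊓ b ∷ w)
  unique-⊓ ((_ ∷ m≢) ∷ b≢ ∷ u) with ≤-total m b
  ... | inj₁ m≤b = subst (λ z → All (z ≢_) w) (sym (m≤n⇒m⊓n≡m m≤b)) m≢ ∷ u
  ... | inj₂ b≤m = subst (λ z → All (z ≢_) w) (sym (m≥n⇒m⊓n≡n b≤m)) b≢ ∷ u
... | inj₁ e       = inj₁ (cong (m ⊔ b ∷_) e)
... | inj₂ (e , d) = inj₂ (cong (m ⊔ b ∷_) e , d)

ExchangeOrDescent : ℕ → List ℕ → List ℕ → Set
ExchangeOrDescent j s t = t ≡ exchange j s ⊎ (t ≡ s × at s (suc (suc j)) < at s (suc j))

shedHead-exchange : ∀ j w → Unique w → suc (suc j) < length w → ExchangeOrDescent j (shedHead w) (shedHead (exchange (suc j) w))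
shedHead-exchange j (b ∷ w) u (s≤s l) = shed-exchange b j w u l

shedHead-generate : ∀ j w → Unique w → suc (suc j) < length w → ExchangeOrDescent j (shedHead w) (shedHead (generate j w))
shedHead-generate j w u l = subst (λ s → ExchangeOrDescent j s (shedHead (generate j w))) (shedHead-exchange-0 w)
  (shedHead-exchange j (exchange 0 w) (Unique-resp-↭ (↭-sym (exchange-↭ 0 w)) u) (subst (suc (suc j) <_) (sym (length-exchange 0 w)) l))

shedHead-generate⁻¹ : ∀ j w → Unique w → suc (suc j) < length w → ExchangeOrDescent j (shedHead w) (shedHead (generate⁻¹ j w))
shedHead-generate⁻¹ j w u l = subst (ExchangeOrDescent j (shedHead w)) (sym (shedHead-exchange-0 (exchange (suc j) w))) (shedHead-exchange j w u l)

exchange-ascent : ∀ {j s t} → suc j < length s → ExchangeOrDescent j s t → at s (suc j) < at s (suc (suc j)) → inv t ≡ suc (inv s)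
exchange-ascent {j} {s} l (inj₁ refl)    a = inv-exchange-ascent j s l a
exchange-ascent         l (inj₂ (_ , d)) a = ⊥-elim (<-asym a d)

-- Equality occurs when the generator does not change the shed word; the weak inequality defining
-- Des_A counts this as a descent.
exchange-descent : ∀ {j s t} → suc j < length s → ExchangeOrDescent j s t → at s (suc (suc j)) < at s (suc j) → inv t ≤ inv s
exchange-descent {j} {s} l (inj₁ refl)       d = ≤-trans (n≤1+n _) (≤-reflexive (inv-exchange-descent j s l d))
exchange-descent         l (inj₂ (refl , _)) d = ≤-refl

length-shedHead : ∀ {w m} → length w ≡ suc m → length (shedHead w) ≡ m
length-shedHead {b ∷ w} l = trans (length-shed b w) (suc-injective l)

Top : ℕ → ℕ → List ℕ → Set
Top t x w = at w (suc t) ≡ x × (∀ {q} → q < t → at w (suc q) < x)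

-- A letter exceeding all earlier ones survives the pass at its place, while the shed entry just
-- before it is the larger of two earlier letters.
top-ascent : ∀ {j x w} → Top (suc (suc j)) x w → suc (suc j) < length w →
  at (shedHead w) (suc j) < at (shedHead w) (suc (suc j))
top-ascent {j} {x} {b ∷ w} (refl , smaller) (s≤s l) = subst₂ _<_ (sym (at-shed b w (<-trans (n<1+n j) l))) (sym (at-shed b w l))
  (<-≤-trans (⊔-lub least< (smaller (n<1+n (suc j)))) (m≤n⊔m _ x))
  where
  least< : least b (take j w) < x
  least< with ∈-take⁻ (suc j) (b ∷ w) (least-∈ b (take j w))
  ... | i , i< , e = subst (_< x) e (smaller (<-trans i< (n<1+n (suc j))))

at-generate : ∀ j w k → suc (suc j) < length w → at (generate j w) k ≡ at w (transpose 0 (transpose (suc j) k))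
at-generate j w k l = trans (at-exchange (suc j) (exchange 0 w) k (subst (suc (suc j) <_) (sym (length-exchange 0 w)) l))
  (at-exchange 0 w (transpose (suc j) k) (≤-<-trans (s≤s z≤n) l))

at-generate⁻¹ : ∀ j w k → suc (suc j) < length w → at (generate⁻¹ j w) k ≡ at w (transpose (suc j) (transpose 0 k))
at-generate⁻¹ j w k l = trans (at-exchange 0 (exchange (suc j) w) k (subst (1 <_) (sym (length-exchange (suc j) w)) (≤-<-trans (s≤s z≤n) l)))
  (at-exchange (suc j) w (transpose 0 k) l)

top-generate : ∀ {j x w} → suc (suc j) < length w → Top (suc (suc j)) x w → Top (suc j) x (generate j w)
top-generate {j} {x} {w} l (top , smaller) =
  trans (at-generate j w (suc (suc j)) l) (trans (cong (at w ∘ transpose 0) (transpose-left (suc j))) top) ,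
  λ {q} q< → case transpose-< {0} {q} {suc (suc j)} (s≤s z<s) (<-trans q< (n<1+n (suc j))) of λ where
    (p , p< , e) → subst (_< x) (sym (trans (at-generate j w (suc q) l)
      (cong (at w) (trans (cong (transpose 0) (transpose-other (<⇒≢ (s≤s q<)) (<⇒≢ (s≤s (<-trans q< (n<1+n (suc j))))))) e)))) (smaller p<)

FixedFrom : ℕ → List ℕ → Set
FixedFrom p w = ∀ {i} → p ≤ i → i < length w → at w (suc i) ≡ suc i

fixed-exchange : ∀ {p j w} → suc j < p → p ≤ length w → FixedFrom p w → FixedFrom p (exchange j w)
fixed-exchange {p} {j} {w} j< p≤ fixed {i} p≤i i< = trans (at-exchange j w (suc i) (<-≤-trans j< p≤))
  (trans (cong (at w) (transpose-other {j} {suc i} (>⇒≢ (s≤s (<-trans (n<1+n j) (<-≤-trans j< p≤i)))) (>⇒≢ (s≤s (<-≤-trans j< p≤i)))))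
    (fixed p≤i (subst (i <_) (length-exchange j w) i<)))

fixed-generate : ∀ {p j w} → suc (suc j) < p → p ≤ length w → FixedFrom p w → FixedFrom p (generate j w)
fixed-generate {p} {j} {w} j< p≤ fixed = fixed-exchange {w = exchange 0 w} j< (subst (p ≤_) (sym (length-exchange 0 w)) p≤)
  (fixed-exchange {w = w} (≤-<-trans (s≤s z≤n) j<) p≤ fixed)

fixed-generate⁻¹ : ∀ {p j w} → suc (suc j) < p → p ≤ length w → FixedFrom p w → FixedFrom p (generate⁻¹ j w)
fixed-generate⁻¹ {p} {j} {w} j< p≤ fixed = fixed-exchange {w = exchange (suc j) w} (≤-<-trans (s≤s z≤n) j<)
  (subst (p ≤_) (sym (length-exchange (suc j) w)) p≤) (fixed-exchange {w = w} j< p≤ fixed)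

fixed-below : ∀ {n p w i} → IsPerm n w → p ≤ n → FixedFrom p w → i < p → ∃ λ k → k < p × at w (suc i) ≡ suc k
fixed-below {n} {p} {w} {i} r p≤ fixed i< with perm-at r (<-≤-trans i< p≤)
... | k , k< , e with <-≤-connex k p
...   | inj₁ k<p = k , k<p , e
...   | inj₂ p≤k = ⊥-elim (<⇒≢ (<-≤-trans i< p≤k) (at-injective (perm-unique r) (len (<-≤-trans i< p≤)) (len k<)
  (trans e (sym (fixed p≤k (len k<))))))
  where
  len : ∀ {q} → q < n → q < length w
  len {q} = subst (q <_) (sym (perm-length r))

-- Words in the generators and their action from the right

act : Letter → List ℕ → List ℕ
act (zero  , _)     w = w
act (suc j , false) w = generate j w
act (suc j , true)  w = generate⁻¹ j w

-- `evalWord` nests its products to the right; here each letter multiplies the permutation reached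
-- so far on the right, which is the operation that `generate` and `generate⁻¹` describe.
run : List Letter → List ℕ → List ℕ
run []      w = w
run (l ∷ u) w = run u (act l w)

run-++ : ∀ u v w → run (u ++ v) w ≡ run v (run u w)
run-++ []      v w = refl
run-++ (l ∷ u) v w = run-++ u v (act l w)

ValidLetter : ℕ → Letter → Set
ValidLetter n l = ∃ λ j → proj₁ l ≡ suc j × suc j < n

act-perm : ∀ {n m w} l → ValidLetter m l → IsPerm n w → IsPerm n (act l w)
act-perm (suc j , false) (_ , refl , _) = generate-perm j
act-perm (suc j , true)  (_ , refl , _) = generate⁻¹-perm j

run-perm : ∀ {n m w u} → All (ValidLetter m) u → IsPerm n w → IsPerm n (run u w)
run-perm []       r = r
run-perm (v ∷ vs) r = run-perm vs (act-perm _ v r)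

letter-perm : ∀ {n} l → ValidLetter n l → IsPerm (suc n) (letterPerm n l)
letter-perm (suc j , false) (_ , refl , j<) = aGen-perm j<
letter-perm (suc j , true)  (_ , refl , j<) = inverse-perm (aGen-perm j<)

compose-letter : ∀ {n w} l → ValidLetter n l → length w ≡ suc n → compose w (letterPerm n l) ≡ act l w
compose-letter {w = w} (suc j , false) (_ , refl , j<) = compose-aGen j< w
compose-letter {w = w} (suc j , true)  (_ , refl , j<) = compose-aGen⁻¹ j< w

compose-evalWord : ∀ {n w} u → All (ValidLetter n) u → IsPerm (suc n) w → compose w (evalWord n u) ≡ run u w
compose-evalWord {w = w} []      []       r = compose-identityʳ w (perm-length r)
compose-evalWord {n} {w} (l ∷ u) (v ∷ vs) r = trans (sym (compose-assoc w (letterPerm n l) (evalWord n u)))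
  (trans (cong (λ z → compose z (evalWord n u)) (compose-letter l v (perm-length r))) (compose-evalWord u vs (act-perm l v r)))

evalWord-run : ∀ {n} u → All (ValidLetter n) u → evalWord n u ≡ run u (range (suc n))
evalWord-run []          []       = refl
evalWord-run {n} (l ∷ u) (v ∷ vs) = trans (compose-evalWord u vs (letter-perm l v))
  (cong (run u) (trans (sym (compose-identityˡ (letter-perm l v))) (compose-letter l v (length-range (suc n)))))

descWord-suc : ∀ j k → descWord j (suc k) ≡ descWord j k ++ (j ∸ k , false) ∷ []
descWord-suc j k = trans (cong (map _) (sym (upTo-∷ʳ k))) (map-++ _ (upTo k) (k ∷ []))

∸-+ : ∀ {j k m} → j + k ≡ m → m ∸ k ≡ j
∸-+ {j} {k} refl = m+n∸n≡m j k

inv-map-suc : ∀ w → inv (map suc w) ≡ inv w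
inv-map-suc []      = refl
inv-map-suc (x ∷ w) = cong₂ _+_ (count-map (_<ᵇ suc x) suc w) (inv-map-suc w)

inv-range : ∀ n → inv (range n) ≡ 0
inv-range zero    = refl
inv-range (suc n) = trans (cong inv (range-suc n)) (cong₂ _+_
  (count-zero (_<ᵇ 1) (map suc (range n)) λ y∈ → case ∈-map⁻ suc y∈ of λ { (_ , _ , refl) → refl })
  (trans (inv-map-suc (range n)) (inv-range n)))

-- The length of a canonical word

module CanonicalWords {n : ℕ} where

  N : ℕ
  N = suc n

  id₀ : List ℕ
  id₀ = range N

  record Canonical (p : ℕ) (u : List Letter) : Set where
    field
      valid : All (ValidLetter n) u
      fixed : FixedFrom p (run u id₀)
      ell   : inv (shedHead (run u id₀)) ≡ length u

    isPerm : IsPerm N (run u id₀)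
    isPerm = run-perm valid (perm ↭-refl)

  open Canonical

  -- The value `p`, larger than all before it, forces an ascent of the shed word where the new
  -- letter acts, so one inversion is gained. Both signs behave alike because `exchange 0` does not
  -- affect the shed word.
  canonical-snoc : ∀ {p u} l j → proj₁ l ≡ suc j → suc (suc j) < p → p ≤ N → Canonical p u →
    Top (suc (suc j)) p (run u id₀) → Canonical p (u ++ l ∷ [])
  canonical-snoc {p} {u} l@(.(suc j) , sign) j refl j< p≤ c t = record
    { valid = All.++⁺ (valid c) ((j , refl , s≤s⁻¹ (<-≤-trans j< p≤)) ∷ [])
    ; fixed = subst (FixedFrom p) (sym (run-++ u (l ∷ []) id₀)) (fixed′ sign)
    ; ell   = trans (cong (inv ∘ shedHead) (run-++ u (l ∷ []) id₀)) (trans (step sign) (trans (cong suc (ell c))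
        (trans (+-comm 1 (length u)) (sym (length-++ u)))))
    }
    where
    σ = run u id₀
    σ-length : length σ ≡ N
    σ-length = perm-length (isPerm c)
    p≤′ : p ≤ length σ
    p≤′ = subst (p ≤_) (sym σ-length) p≤
    l<′ : suc (suc j) < length σ
    l<′ = <-≤-trans j< p≤′
    s-length : suc j < length (shedHead σ)
    s-length = subst (suc j <_) (sym (length-shedHead {σ} σ-length)) (s≤s⁻¹ (<-≤-trans j< p≤))
    fixed′ : ∀ sign → FixedFrom p (act (suc j , sign) σ)
    fixed′ false = fixed-generate {w = σ} j< p≤′ (fixed c)
    fixed′ true  = fixed-generate⁻¹ {w = σ} j< p≤′ (fixed c)
    step : ∀ sign → inv (shedHead (act (suc j , sign) σ)) ≡ suc (inv (shedHead σ))
    step false = exchange-ascent s-length (shedHead-generate j σ (perm-unique (isPerm c)) l<′) (top-ascent {w = σ} t l<′)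
    step true  = exchange-ascent s-length (shedHead-generate⁻¹ j σ (perm-unique (isPerm c)) l<′) (top-ascent {w = σ} t l<′)

  -- After `k` letters of the factor the value m+3 has moved `k` places left from its own place.
  -- Everything before it is smaller, which is what the next letter requires.
  canonical-desc : ∀ {m u} → suc m < n → Canonical (suc (suc m)) u → ∀ k j → j + k ≡ suc m →
    Canonical (suc (suc (suc m))) (u ++ descWord (suc m) k) × Top (suc j) (suc (suc (suc m))) (run (u ++ descWord (suc m) k) id₀)
  canonical-desc {m} {u} m< c zero j e with trans (sym (+-identityʳ j)) e
  ... | refl = subst (λ v → Canonical p v × Top (suc (suc m)) p (run v id₀)) (sym (++-identityʳ u))
    ( record { valid = valid c ; fixed = λ p≤i → fixed c (≤-trans (n≤1+n _) p≤i) ; ell = ell c }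
    , fixed c ≤-refl (subst (suc (suc m) <_) (sym (perm-length (isPerm c))) (s≤s m<))
    , λ q< → case fixed-below (isPerm c) (s≤s (<⇒≤ m<)) (fixed c) q< of λ { (k , k< , e′) → ≤-<-trans (≤-reflexive e′) (s≤s k<) })
    where p = suc (suc (suc m))
  canonical-desc {m} {u} m< c (suc k) j e with canonical-desc m< c k (suc j) (trans (sym (+-suc j k)) e)
  ... | c′ , t = subst (λ v → Canonical p v × Top (suc j) p (run v id₀)) word
    ( canonical-snoc (suc m ∸ k , false) j letter (s≤s (s≤s j<)) (s≤s m<) c′ t
    , subst (Top (suc j) p) (sym (trans (run-++ (u ++ descWord (suc m) k) _ id₀) (cong (λ i → act (i , false) σ) letter)))
        (top-generate {w = σ} (subst (suc (suc j) <_) (sym (perm-length (isPerm c′))) (<-≤-trans (s≤s (s≤s j<)) (s≤s m<))) t))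
    where
    p = suc (suc (suc m))
    σ = run (u ++ descWord (suc m) k) id₀
    e′ : j + k ≡ m
    e′ = suc-injective (trans (sym (+-suc j k)) e)
    j< : j < suc m
    j< = s≤s (subst (j ≤_) e′ (m≤m+n j k))
    letter : suc m ∸ k ≡ suc j
    letter = ∸-+ (cong suc e′)
    word : (u ++ descWord (suc m) k) ++ (suc m ∸ k , false) ∷ [] ≡ u ++ descWord (suc m) (suc k)
    word = trans (++-assoc u (descWord (suc m) k) _) (cong (u ++_) (sym (descWord-suc (suc m) k)))

  canonical : ∀ m {u} → m < n → u ∈ canonWords m → Canonical (suc (suc m)) u
  canonical zero    m< (here refl) = record
    { valid = [] ; fixed = λ {i} _ i< → at-range (subst (i <_) (length-range N) i<) ; ell = ell-id }
    where
    ell-id : inv (shedHead id₀) ≡ 0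
    ell-id = trans (cong (inv ∘ shedHead) (range-suc n)) (trans (cong inv (shed-identity (range n))) (trans (inv-map-suc (range n)) (inv-range n)))
      where
      shed-identity : ∀ w → shed 1 (map suc w) ≡ map suc w
      shed-identity []      = refl
      shed-identity (x ∷ w) = cong (suc x ∷_) (shed-identity w)
  canonical (suc m) m< u∈ with ∈-concatMap⁻ (λ w → map (w ++_) (RA (suc m))) (canonWords m) u∈
  ... | w , w∈ , u∈′ with ∈-map⁻ (w ++_) u∈′
  ...   | r , r∈ , refl with canonical m (<-trans (n<1+n m) m<) w∈ | ∈-++⁻ (map (descWord (suc m)) (upTo (suc (suc m)))) r∈
  ...     | c | inj₁ r∈′ with ∈-map⁻ (descWord (suc m)) r∈′
  ...       | k , k∈ , refl = proj₁ (canonical-desc m< c k (suc m ∸ k) (m∸n+n≡m (s≤s⁻¹ (∈-upTo⁻ k∈))))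
  -- The exceptional factor: after the letters with indices m+1 down to 2 the value m+3 is in third
  -- place, and the inverse of a_1 takes it to the first.
  canonical (suc m) m< u∈ | w , w∈ , u∈′ | r , r∈ , refl | c | inj₂ (here refl) with canonical-desc m< c m 1 refl
  ... | c′ , t = subst (Canonical _) (++-assoc w (descWord (suc m) m) _) (canonical-snoc (1 , true) 0 refl (s≤s (s≤s z<s)) (s≤s m<) c′ t)

generate⁻¹-generate : ∀ j w → generate⁻¹ j (generate j w) ≡ w
generate⁻¹-generate j w = trans (cong (exchange 0) (exchange-involutive (suc j) (exchange 0 w))) (exchange-involutive 0 w)

-- Existence of canonical words

module CanonicalExistence {n : ℕ} where

  open CanonicalWords {n} using (N; id₀)

  Represented : ℕ → List ℕ → Set
  Represented m w = ∃ λ u → u ∈ canonWords m × run u id₀ ≡ w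

  -- Only the first two places may move, so `w` is the identity or s_1, and parity excludes s_1.
  represented-zero : ∀ {w} → 0 < n → IsEvenPerm N w → FixedFrom 2 w → Represented 0 w
  represented-zero {w} 0<n (r , ev) fixed = [] , here refl , sym (cases first second)
    where
    first = fixed-below r (s≤s 0<n) fixed z<s
    second = fixed-below r (s≤s 0<n) fixed (s≤s z<s)
    len : ∀ {i} → i < N → i < length w
    len {i} = subst (i <_) (sym (perm-length r))
    identity : at w 1 ≡ 1 → at w 2 ≡ 2 → w ≡ id₀
    identity e₁ e₂ = at-ext w id₀ (trans (perm-length r) (sym (length-range N)))
      λ {i} i< → trans (fix i i<) (sym (at-range (subst (i <_) (perm-length r) i<)))
      where
      fix : ∀ i → i < length w → at w (suc i) ≡ suc i
      fix zero          _  = e₁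
      fix (suc zero)    _  = e₂
      fix (suc (suc i)) i< = fixed (s≤s (s≤s z≤n)) i<
    clash : ∀ {A : Set} → at w 1 ≡ at w 2 → A
    clash e = ⊥-elim (case at-injective (perm-unique r) (len z<s) (len (s≤s 0<n)) e of λ ())
    swapped : at w 1 ≡ 2 → at w 2 ≡ 1 → exchange 0 w ≡ id₀
    swapped e₁ e₂ = at-ext (exchange 0 w) id₀ (trans (perm-length (exchange-perm 0 r)) (sym (length-range N)))
      λ {i} i< → trans (fix i (subst (i <_) (length-exchange 0 w) i<)) (sym (at-range (subst (i <_) (perm-length (exchange-perm 0 r)) i<)))
      where
      fix : ∀ i → i < length w → at (exchange 0 w) (suc i) ≡ suc i
      fix zero          _  = trans (at-exchange 0 w 1 (len (s≤s 0<n))) e₂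
      fix (suc zero)    _  = trans (at-exchange 0 w 2 (len (s≤s 0<n))) e₁
      fix (suc (suc i)) i< = trans (at-exchange 0 w (suc (suc (suc i))) (len (s≤s 0<n))) (fixed (s≤s (s≤s z≤n)) i<)
    odd : exchange 0 w ≡ id₀ → true ≡ false
    odd e = trans (sym (cong even (inv-range N))) (trans (cong (even ∘ inv) (sym e))
      (trans (even-inv-exchange 0 w (perm-unique r) (len (s≤s 0<n))) (cong not ev)))
    cases : (∃ λ k → k < 2 × at w 1 ≡ suc k) → (∃ λ k → k < 2 × at w 2 ≡ suc k) → w ≡ id₀
    cases (0 , _ , e₁) (0 , _ , e₂) = clash (trans e₁ (sym e₂))
    cases (0 , _ , e₁) (1 , _ , e₂) = identity e₁ e₂
    cases (1 , _ , e₁) (0 , _ , e₂) = ⊥-elim (case odd (swapped e₁ e₂) of λ ())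
    cases (1 , _ , e₁) (1 , _ , e₂) = clash (trans e₁ (sym e₂))
    cases (suc (suc _) , s≤s (s≤s ()) , _) _
    cases _ (suc (suc _) , s≤s (s≤s ()) , _)

  module _ {m : ℕ} (m< : suc m < n) (represented : ∀ {w} → IsEvenPerm N w → FixedFrom (suc (suc m)) w → Represented m w) where

    private p = suc (suc (suc m))

    -- Letters are undone one at a time, each moving the value `p` one place to the right, until it
    -- is in its own place and the shorter word of the hypothesis applies.
    represented-desc : ∀ k j {w} → j + k ≡ suc m → IsEvenPerm N w → FixedFrom p w → at w (suc (suc j)) ≡ p →
      ∃ λ u → u ∈ canonWords m × run (u ++ descWord (suc m) k) id₀ ≡ w
    represented-desc zero j {w} e ev fixed top with trans (sym (+-identityʳ j)) e
    ... | refl = case represented ev fixed′ of λ where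
          (u , u∈ , e′) → u , u∈ , trans (cong (λ v → run v id₀) (++-identityʳ u)) e′
      where
      fixed′ : FixedFrom (suc (suc m)) w
      fixed′ q≤i i< with m≤n⇒m<n∨m≡n q≤i
      ... | inj₁ q<i  = fixed q<i i<
      ... | inj₂ refl = top
    represented-desc (suc k) j {w} e ev fixed top =
      case represented-desc k (suc j) (trans (sym (+-suc j k)) e) (generate⁻¹-even j<n ev) (fixed-generate⁻¹ {w = w} (s≤s (s≤s j<)) p≤ fixed) top′ of λ where
        (u , u∈ , e′) → u , u∈ , trans (cong (λ v → run v id₀) (word u)) (trans (run-++ (u ++ descWord (suc m) k) _ id₀)
          (trans (cong₂ (λ i z → act (i , false) z) letter e′) (generate-generate⁻¹ j w)))
      where
      e″ : j + k ≡ m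
      e″ = suc-injective (trans (sym (+-suc j k)) e)
      j< : j < suc m
      j< = s≤s (subst (j ≤_) e″ (m≤m+n j k))
      j<n : suc j < n
      j<n = ≤-<-trans j< m<
      p≤ : p ≤ length w
      p≤ = subst (p ≤_) (sym (perm-length (proj₁ ev))) (s≤s m<)
      letter : suc m ∸ k ≡ suc j
      letter = ∸-+ (cong suc e″)
      word : ∀ u → u ++ descWord (suc m) (suc k) ≡ (u ++ descWord (suc m) k) ++ (suc m ∸ k , false) ∷ []
      word u = trans (cong (u ++_) (descWord-suc (suc m) k)) (sym (++-assoc u (descWord (suc m) k) _))
      top′ : at (generate⁻¹ j w) (suc (suc (suc j))) ≡ p
      top′ = trans (at-generate⁻¹ j w (suc (suc (suc j))) (≤-trans (s≤s (s≤s j<)) p≤)) (trans (cong (at w) (transpose-right (suc j))) top)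

    -- The place of the value `p` selects the factor: the first place belongs to the factor ending
    -- in the inverse of a_1, and each place from the second to the last to one of the descending
    -- words.
    represented-suc : ∀ {w} → IsEvenPerm N w → FixedFrom p w → Represented (suc m) w
    represented-suc {w} ev@(r , _) fixed with ∈-at (perm-∈ r (s≤s m<))
    ... | zero , _ , top = case represented-desc m 1 refl (generate-even {j = 0} 1<n ev) (fixed-generate {w = w} (s≤s (s≤s z<s)) p≤ fixed) top′ of λ where
          (u , u∈ , e) → u ++ (descWord (suc m) m ++ (1 , true) ∷ [])
            , ∈-concatMap⁺ (λ w → map (w ++_) (RA (suc m))) u∈ (∈-map⁺ (u ++_) (∈-++⁺ʳ (map (descWord (suc m)) (upTo (suc (suc m)))) (here refl)))
            , trans (cong (λ v → run v id₀) (sym (++-assoc u (descWord (suc m) m) _)))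
                (trans (run-++ (u ++ descWord (suc m) m) _ id₀) (trans (cong (generate⁻¹ 0) e) (generate⁻¹-generate 0 w)))
      where
      1<n : 1 < n
      1<n = ≤-<-trans (s≤s z≤n) m<
      p≤ : p ≤ length w
      p≤ = subst (p ≤_) (sym (perm-length r)) (s≤s m<)
      top′ : at (generate 0 w) 3 ≡ p
      top′ = trans (at-generate 0 w 3 (≤-trans (s≤s (s≤s (s≤s z≤n))) p≤)) top
    ... | suc j , j< , top = case represented-desc (suc m ∸ j) j (m+[n∸m]≡n j≤) ev fixed top of λ where
          (u , u∈ , e) → u ++ descWord (suc m) (suc m ∸ j)
            , ∈-concatMap⁺ (λ w → map (w ++_) (RA (suc m))) u∈ (∈-map⁺ (u ++_)
                (∈-++⁺ˡ (∈-map⁺ (descWord (suc m)) (∈-upTo⁺ (s≤s (m∸n≤m (suc m) j))))))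
            , e
      where
      j≤ : j ≤ suc m
      j≤ with <-≤-connex (suc m) j
      ... | inj₂ j≤ = j≤
      ... | inj₁ m<j = ⊥-elim (<⇒≢ (s≤s (s≤s m<j)) (trans (sym top) (fixed (s≤s m<j) j<)))

  represented : ∀ m {w} → m < n → IsEvenPerm N w → FixedFrom (suc (suc m)) w → Represented m w
  represented zero    m< = represented-zero m<
  represented (suc m) m< = represented-suc m< (represented m (<-trans (n<1+n m) m<))

-- The search that defines the alternating length

firstLength : ℕ → List ℕ → List (List Letter) → ℕ
firstLength n σ []       = 0
firstLength n σ (w ∷ ws) = if listEqᵇ (evalWord n w) σ then length w else firstLength n σ ws

AgreesWithFirstLength : (ℕ → List ℕ → List (List Letter) → ℕ) → Set
AgreesWithFirstLength h = ∀ n σ ws → h n σ ws ≡ firstLength n σ ws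

-- The search inside lenA is a local function; unification supplies it for the underscore.
mutual
  lenA-firstLength : ∀ n σ → lenA n σ ≡ firstLength n σ (canonWords (n ∸ 1))
  lenA-firstLength n σ with canonWords (n ∸ 1)
  ... | ws = search-firstLength n σ ws

  search-firstLength : AgreesWithFirstLength _
  search-firstLength n σ []       = refl
  search-firstLength n σ (w ∷ ws) with listEqᵇ (evalWord n w) σ
  ... | true  = refl
  ... | false = search-firstLength n σ ws

-- All matching words have the same length, so it does not matter which of them the search meets
-- first.
firstLength-found : ∀ {n σ k} ws → (∃ λ w → w ∈ ws × evalWord n w ≡ σ) →
  (∀ {w} → w ∈ ws → evalWord n w ≡ σ → length w ≡ k) → firstLength n σ ws ≡ k
firstLength-found {n} {σ} (w ∷ ws) found all-k with ≡-dec _≟_ (evalWord n w) σ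
... | yes e = all-k (here refl) e
firstLength-found (w ∷ ws) (v , here refl , e) all-k | no ¬e = ⊥-elim (¬e e)
firstLength-found (w ∷ ws) (v , there v∈ , e)  all-k | no ¬e = firstLength-found ws (v , v∈ , e) (all-k ∘ there)

lenA-shedHead : ∀ {n σ} → 0 < n → IsEvenPerm (suc n) σ → lenA n σ ≡ inv (shedHead σ)
lenA-shedHead {suc n} {σ} _ ev@(r , _) = trans (lenA-firstLength (suc n) σ) (firstLength-found (canonWords n)
  -- At the last stage every place may move, so the condition on fixed places is vacuous.
  (case represented n ≤-refl ev (λ n≤i i< → ⊥-elim (<⇒≱ (subst (_ <_) (perm-length r) i<) n≤i)) of λ where
    (u , u∈ , e) → u , u∈ , trans (evalWord-run u (valid (canonical n ≤-refl u∈))) e)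
  λ {u} u∈ e → let c = canonical n ≤-refl u∈ in
    trans (sym (ell c)) (cong (inv ∘ shedHead) (trans (sym (evalWord-run u (valid c))) e)))
  where
  open CanonicalWords {suc n}
  open Canonical
  open CanonicalExistence {suc n}

-- Lifting Foata's bijection through the covering map

minima : ℕ → List ℕ → List ℕ
minima m []      = []
minima m (b ∷ w) = if b <ᵇ m then b ∷ minima b w else minima m w

-- The substitution that undoes `shed`: each value of the chain `m ∷ C` goes to its successor. The
-- last one is kept, but a shed word does not contain it.
next : ℕ → List ℕ → ℕ → ℕ
next m []      x = x
next m (c ∷ C) x = if x ≡ᵇ m then c else next c C x

-- τ arises by shed from a word whose left-to-right minima are m ∷ C.
MinimaChain : ℕ → List ℕ → List ℕ → Set
MinimaChain m []      τ = All (m <_) τ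
MinimaChain m (c ∷ C) τ = c < m × m ∈ τ × leftToRightMinimum m τ ≡ true × MinimaChain c C τ

next-fixed : ∀ m C {x} → x ∉ m ∷ C → next m C x ≡ x
next-fixed m []      x∉ = refl
next-fixed m (c ∷ C) {x} x∉ rewrite ≡ᵇ-false {x} {m} (x∉ ∘ here) = next-fixed c C (x∉ ∘ there)

next-≢ : ∀ m c C {x} → x ≢ m → next m (c ∷ C) x ≡ next c C x
next-≢ m c C x≢m rewrite ≡ᵇ-false x≢m = refl

next-≡ : ∀ m c C → next m (c ∷ C) m ≡ c
next-≡ m c C rewrite ≡ᵇ-true {m} refl = refl

minima-⊆ : ∀ m w {x} → x ∈ minima m w → x ∈ w
minima-⊆ m (b ∷ w) x∈ with b <ᵇ m
minima-⊆ m (b ∷ w) (here refl) | true  = here refl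
minima-⊆ m (b ∷ w) (there x∈)  | true  = there (minima-⊆ b w x∈)
minima-⊆ m (b ∷ w) x∈          | false = there (minima-⊆ m w x∈)

shed-⊆ : ∀ m w {x} → x ∈ shed m w → x ∈ m ∷ w
shed-⊆ m w x∈ = ∈-resp-↭ (↭-sym (shed-↭ m w)) (there x∈)

-- `shed` writes the old minimum where a new one appears and keeps all other letters, none of which
-- is on the chain. So the word is recovered by substituting values, an operation that also makes
-- sense after the shed word has been rearranged.
next-shed : ∀ m w → Unique (m ∷ w) → map (next m (minima m w)) (shed m w) ≡ w
next-shed m []      _ = refl
next-shed m (b ∷ w) ((m≢b ∷ m≢) ∷ b≢ ∷ u) with b <ᵇ m in e
... | true  rewrite m≥n⇒m⊔n≡m (<⇒≤ (<ᵇ-true⁻ b m e)) | m≥n⇒m⊓n≡n (<⇒≤ (<ᵇ-true⁻ b m e)) =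
  cong₂ _∷_ (next-≡ m b (minima b w)) (trans
    (map-cong-local (All.tabulate λ x∈ → next-≢ m b (minima b w) λ { refl → ∉-All (m≢b ∷ m≢) (shed-⊆ b w x∈) }))
    (next-shed b w (b≢ ∷ u)))
... | false rewrite m≤n⇒m⊔n≡n (<ᵇ-false⁻ b m e) | m≤n⇒m⊓n≡m (<ᵇ-false⁻ b m e) =
  cong₂ _∷_ (next-fixed m (minima m w) λ { (here refl) → m≢b refl ; (there b∈) → ∉-All b≢ (minima-⊆ m w b∈) })
    (next-shed m w (m≢ ∷ u))

minimum-skip : ∀ {i x} τ → i < x → leftToRightMinimum i (x ∷ τ) ≡ leftToRightMinimum i τ
minimum-skip τ i<x rewrite ≡ᵇ-false (<⇒≢ i<x) | <ᵇ-false (<⇒≤ i<x) = refl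

minimum-head : ∀ {i} τ → leftToRightMinimum i (i ∷ τ) ≡ true
minimum-head {i} τ rewrite ≡ᵇ-true {i} refl = refl

minimum-≤ : ∀ {i x τ} → leftToRightMinimum i (x ∷ τ) ≡ true → i ≤ x
minimum-≤ {i} {x} e with i ≡ᵇ x in ix | x <ᵇ i in xi
... | true  | _     = ≤-reflexive (≡ᵇ⇒≡ i x (true-T ix))
... | false | false = <ᵇ-false⁻ x i xi

chain-∷ : ∀ {m y τ} C → m < y → MinimaChain m C τ → MinimaChain m C (y ∷ τ)
chain-∷ []      m<y h = m<y ∷ h
chain-∷ {τ = τ} (c ∷ C) m<y (c<m , m∈ , min , h) = c<m , there m∈ , trans (minimum-skip τ m<y) min , chain-∷ C (<-trans c<m m<y) h

chain-tail : ∀ {m y τ} C → m < y → MinimaChain m C (y ∷ τ) → MinimaChain m C τ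
chain-tail []      m<y (_ ∷ h) = h
chain-tail (c ∷ C) m<y (c<m , here refl , _ , _) = ⊥-elim (<-irrefl refl m<y)
chain-tail {τ = τ} (c ∷ C) m<y (c<m , there m∈ , min , h) =
  c<m , m∈ , trans (sym (minimum-skip τ m<y)) min , chain-tail C (<-trans c<m m<y) h

-- A minimum is written down at the place where it is undercut, and all that was emitted before it
-- is larger. Hence it is a left-to-right minimum of the shed word.
chain-shed : ∀ m w → Unique (m ∷ w) → MinimaChain m (minima m w) (shed m w)
chain-shed m []      _ = []
chain-shed m (b ∷ w) ((m≢b ∷ m≢) ∷ b≢ ∷ u) with b <ᵇ m in e
... | true  rewrite m≥n⇒m⊔n≡m (<⇒≤ (<ᵇ-true⁻ b m e)) | m≥n⇒m⊓n≡n (<⇒≤ (<ᵇ-true⁻ b m e)) =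
  <ᵇ-true⁻ b m e , here refl , minimum-head {m} (shed b w) , chain-∷ (minima b w) (<ᵇ-true⁻ b m e) (chain-shed b w (b≢ ∷ u))
... | false rewrite m≤n⇒m⊔n≡n (<ᵇ-false⁻ b m e) | m≤n⇒m⊓n≡m (<ᵇ-false⁻ b m e) =
  chain-∷ (minima m w) (≤∧≢⇒< (<ᵇ-false⁻ b m e) m≢b) (chain-shed m w (m≢ ∷ u))

chain-foata : ∀ {m τ} C → MinimaChain m C τ → MinimaChain m C (foata τ)
chain-foata {τ = τ} []      h = All-resp-↭ (↭-sym (foata-↭ τ)) h
chain-foata {m} {τ} (c ∷ C) (c<m , m∈ , min , h) =
  c<m , ∈-resp-↭ (↭-sym (foata-↭ τ)) m∈ , trans (leftToRightMinimum-foata m τ) min , chain-foata C h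

chain-below : ∀ {m τ} C {x} → MinimaChain m C τ → m < x → x ∉ m ∷ C
chain-below C       h             m<x (here refl) = <-irrefl refl m<x
chain-below {τ = τ} (c ∷ C) (c<m , _ , _ , h) m<x (there x∈) = chain-below {τ = τ} C h (<-trans c<m m<x) x∈

shed-above : ∀ {y z τ C} m w → m < y → z ≡ y → shed m w ≡ τ × minima m w ≡ C →
  shed m (z ∷ w) ≡ y ∷ τ × minima m (z ∷ w) ≡ C
shed-above m w m<y refl (refl , refl)
  rewrite m≤n⇒m⊔n≡n (<⇒≤ m<y) | m≤n⇒m⊓n≡m (<⇒≤ m<y) | <ᵇ-false (<⇒≤ m<y) = refl , refl

-- Letters before `m` in `τ` exceed it and are off the chain, so substitution and pass both keep
-- them. At `m` the substitution writes the smaller `c`; the pass emits `m` again and goes on with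
-- `c` as minimum.
shed-next : ∀ m C τ → Unique τ → MinimaChain m C τ →
  shed m (map (next m C) τ) ≡ τ × minima m (map (next m C) τ) ≡ C
shed-next m []      []      _ _ = refl , refl
shed-next m (c ∷ C) (y ∷ τ) (y≢ ∷ u) (c<m , m∈ , min , h) with m≤n⇒m<n∨m≡n (minimum-≤ {m} {y} {τ} min)
... | inj₂ refl
  rewrite next-≡ m c C | m≥n⇒m⊔n≡m (<⇒≤ c<m) | m≥n⇒m⊓n≡n (<⇒≤ c<m) | <ᵇ-true c<m
  | map-cong-local (All.map (λ {x} m≢x → next-≢ m c C {x} (m≢x ∘ sym)) y≢) =
  let (p , q) = shed-next c C τ u (chain-tail C c<m h) in cong (m ∷_) p , cong (c ∷_) q
... | inj₁ m<y = shed-above m (map (next m (c ∷ C)) τ) m<y (next-fixed m (c ∷ C) (chain-below (c ∷ C) (c<m , m∈ , min , h) m<y))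
  (shed-next m (c ∷ C) τ u (chain-tail (c ∷ C) m<y (c<m , m∈ , min , h)))
shed-next m []      (y ∷ τ) (y≢ ∷ u) (m<y ∷ h) = shed-above m (map id τ) m<y refl (shed-next m [] τ u h)

lift : List ℕ → List ℕ
lift []      = []
lift (b ∷ w) = b ∷ map (next b (minima b w)) (foata (shed b w))

lift-↭ : ∀ v → Unique v → lift v ↭ v
lift-↭ []      u = ↭-refl
lift-↭ (b ∷ w) u = prep b (↭-trans (↭-map (next b (minima b w)) (foata-↭ (shed b w))) (↭-reflexive (next-shed b w u)))

lift-shed : ∀ b w → Unique (b ∷ w) → let w′ = map (next b (minima b w)) (foata (shed b w)) in
  shed b w′ ≡ foata (shed b w) × minima b w′ ≡ minima b w
lift-shed b w u = shed-next b (minima b w) (foata (shed b w)) (Unique-resp-↭ (↭-sym (foata-↭ (shed b w))) unique-shed)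
  (chain-foata (minima b w) (chain-shed b w u))
  where
  unique-shed : Unique (shed b w)
  unique-shed with Unique-resp-↭ (shed-↭ b w) u
  ... | _ ∷ u′ = u′

-- The minima of the lifted word are those of the original, and its shed word is the Foata transform
-- of the original one. Both are thus known, and `next-shed` rebuilds the original.
lift-injective : ∀ v v′ → Unique v → Unique v′ → lift v ≡ lift v′ → v ≡ v′
lift-injective []      []        u u′ e = refl
lift-injective (b ∷ w) (b′ ∷ w′) u u′ e with ∷-injectiveˡ e
... | refl = cong (b ∷_) (trans (sym (next-shed b w u)) (trans (cong₂ (λ C s → map (next b C) s)
    (trans (sym (proj₂ (lift-shed b w u))) (trans (cong (minima b) (∷-injectiveʳ e)) (proj₂ (lift-shed b w′ u′))))
    (foata-injective _ _ (trans (sym (proj₁ (lift-shed b w u))) (trans (cong (shed b) (∷-injectiveʳ e)) (proj₁ (lift-shed b w′ u′))))))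
  (next-shed b w′ u′)))

carry-map-suc : ∀ (p q : ℕ → Bool) → (∀ y → p (suc y) ≡ q y) → ∀ c w → carry p (suc c) (map suc w) ≡ map suc (carry q c w)
carry-map-suc p q h c []      = refl
carry-map-suc p q h c (b ∷ w) rewrite h b with q b
... | true  = cong (suc c ∷_) (carry-map-suc p q h b w)
... | false = cong (suc b ∷_) (carry-map-suc p q h c w)

rotate-map-suc : ∀ x w → rotate (suc x) (map suc w) ≡ map suc (rotate x w)
rotate-map-suc x []      = refl
rotate-map-suc x (c ∷ w) = carry-map-suc _ _ (side (c <ᵇ x)) c w
  where
  side : ∀ b y → sameSide (suc x) b (suc y) ≡ sameSide x b y
  side true  y = refl
  side false y = refl

-- Foata's map only compares letters, so it commutes with the shift of values between `shed` and
-- `cover`.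
foata-map-suc : ∀ w → foata (map suc w) ≡ map suc (foata w)
foata-map-suc []      = refl
foata-map-suc (x ∷ w) = cong (suc x ∷_) (trans (cong (rotate (suc x)) (foata-map-suc w)) (rotate-map-suc x (foata w)))

cover-lift : ∀ {n v} → IsPerm (suc n) v → cover (lift v) ≡ foata (cover v)
cover-lift {v = []}    r = refl
cover-lift {v = b ∷ w} r = begin
  map pred (shedHead (lift (b ∷ w)))       ≡⟨ cong (map pred) (proj₁ (lift-shed b w (perm-unique r))) ⟩
  map pred (foata (shed b w))              ≡⟨ cong (map pred ∘ foata) (sym (suc-cover r)) ⟩
  map pred (foata (map suc (cover (b ∷ w)))) ≡⟨ cong (map pred) (foata-map-suc (cover (b ∷ w))) ⟩
  map pred (map suc (foata (cover (b ∷ w)))) ≡⟨ trans (sym (map-∘ (foata (cover (b ∷ w))))) (map-id _) ⟩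
  foata (cover (b ∷ w)) ∎
  where open ≡-Reasoning

-- Transfer of the statistics

module _ {n : ℕ} {σ : List ℕ} (0<n : 0 < n) (ev : IsEvenPerm (suc n) σ) where

  inv-shedHead : inv (shedHead σ) ≡ inv (cover σ)
  inv-shedHead = go σ (proj₁ ev)
    where
    go : ∀ σ → IsPerm (suc n) σ → inv (shedHead σ) ≡ inv (cover σ)
    go []      r = refl
    go (b ∷ w) r = trans (cong inv (sym (suc-cover r))) (inv-map-suc (cover (b ∷ w)))

  lenA-cover : lenA n σ ≡ lenS (cover σ)
  lenA-cover = trans (lenA-shedHead 0<n ev) (trans inv-shedHead (sym (lenS≡inv (cover σ))))

  -- The two lengths compared are the inversion numbers of shed words related by
  -- `ExchangeOrDescent`: an ascent lengthens, a descent does not, and equal entries cannot occur.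
  isDesA-cover : ∀ {j} → suc j < n → isDesA n σ (suc j) ≡ isDesS (cover σ) (suc j)
  isDesA-cover {j} j< = begin
    lenA n (compose σ (aGen n (suc j))) ≤ᵇ lenA n σ
      ≡⟨ cong₂ _≤ᵇ_ (trans (cong (lenA n) (compose-aGen j< σ (perm-length r))) (lenA-shedHead 0<n (generate-even j< ev))) (lenA-shedHead 0<n ev) ⟩
    inv t ≤ᵇ inv s                      ≡⟨ decide (<-cmp (at s (suc (suc j))) (at s (suc j))) ⟩
    at s (suc (suc j)) <ᵇ at s (suc j)  ≡⟨ cong₂ _<ᵇ_ (at-s j<) (at-s (<-trans (n<1+n j) j<)) ⟩
    isDesS (cover σ) (suc j) ∎
    where
    open ≡-Reasoning
    r = proj₁ ev
    s = shedHead σ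
    t = shedHead (generate j σ)
    s-length : length s ≡ n
    s-length = length-shedHead {σ} (perm-length r)
    j<s : suc j < length s
    j<s = subst (suc j <_) (sym s-length) j<
    step : ExchangeOrDescent j s t
    step = shedHead-generate j σ (perm-unique r) (subst (suc (suc j) <_) (sym (perm-length r)) (s≤s j<))
    at-s : ∀ {i} → i < n → at s (suc i) ≡ suc (at (cover σ) (suc i))
    at-s = go σ r
      where
      go : ∀ σ → IsPerm (suc n) σ → ∀ {i} → i < n → at (shedHead σ) (suc i) ≡ suc (at (cover σ) (suc i))
      go []      r = ⊥-elim (case perm-length r of λ ())
      go (b ∷ w) r i< = sym (suc-at-cover r i<)
    decide : Tri (at s (suc (suc j)) < at s (suc j)) (at s (suc (suc j)) ≡ at s (suc j)) (at s (suc j) < at s (suc (suc j))) →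
      (inv t ≤ᵇ inv s) ≡ (at s (suc (suc j)) <ᵇ at s (suc j))
    decide (tri< d _ _) = trans (T-true (≤⇒≤ᵇ (exchange-descent j<s step d))) (sym (<ᵇ-true d))
    decide (tri≈ _ e _) = ⊥-elim (>⇒≢ (n<1+n j) (at-injective (perm-unique (cover-perm r))
      (subst (suc j <_) (sym (perm-length (cover-perm r))) j<) (subst (j <_) (sym (perm-length (cover-perm r))) (<-trans (n<1+n j) j<))
      (suc-injective (trans (sym (at-s j<)) (trans e (at-s (<-trans (n<1+n j) j<)))))))
    decide (tri> _ _ a) = trans (cong (_≤ᵇ inv s) (exchange-ascent j<s step a)) (trans (<ᵇ-false {inv s} ≤-refl) (sym (<ᵇ-false (<⇒≤ a))))

  isDesA-cover-∈ : ∀ {i} → i ∈ range (n ∸ 1) → isDesA n σ i ≡ isDesS (cover σ) i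
  isDesA-cover-∈ i∈ with ∈-range⁻ i∈
  ... | j , j< , refl = isDesA-cover (subst (suc j <_) (m+[n∸m]≡n 0<n) (s≤s j<))

  rmajA-cover : rmajA n σ ≡ rmajS (cover σ)
  rmajA-cover = trans (cong (sum ∘ map (n ∸_)) (filterᵇ-cong (range (n ∸ 1)) isDesA-cover-∈))
    (cong (λ m → sum (map (m ∸_) (filterᵇ (isDesS (cover σ)) (range (m ∸ 1))))) (sym (perm-length (cover-perm (proj₁ ev)))))

  desASubᵇ-cover : ∀ D → desASubᵇ n σ D ≡ desSSubᵇ (cover σ) D
  desASubᵇ-cover D = trans (all-cong (range (n ∸ 1)) (λ {i} i∈ → cong (λ b → not b ∨ memᵇ i D) (isDesA-cover-∈ i∈)))
    (cong (λ m → all (λ i → not (isDesS (cover σ) i) ∨ memᵇ i D) (range (m ∸ 1))) (sym (perm-length (cover-perm (proj₁ ev)))))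

-- Del_A is Del_S of the cover moved up by one, while `D₂` stays where it is: the cover is tested at
-- i - 1 and `D₂` at i.
delCovered : ℕ → List ℕ → List ℕ → Bool
delCovered n w D = all (λ i → not (isDelS w (i ∸ 1)) ∨ memᵇ i D) (interval 3 (suc n))

delCovered-cong : ∀ {n D} (p : ℕ → Bool) w → (∀ {i} → i < n → p (suc (suc i)) ≡ isDelS w (suc i)) →
  all (λ i → not (p i) ∨ memᵇ i D) (interval 3 (suc n)) ≡ delCovered n w D
delCovered-cong {n} {D} p w h = all-cong (interval 3 (suc n)) λ i∈ → step (∈-interval⁻ 3 (suc n) i∈)
  where
  step : ∀ {i} → 3 ≤ i × i ≤ suc n → (not (p i) ∨ memᵇ i D) ≡ (not (isDelS w (i ∸ 1)) ∨ memᵇ i D)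
  step {suc (suc i)} (_ , s≤s i<) = cong (λ b → not b ∨ memᵇ (suc (suc i)) D) (h i<)
  step {suc zero} (s≤s () , _)

aIndexed : ℕ → List ℕ → List ℕ → List ℕ → Bool
aIndexed n D₁ D₂ σ = desASubᵇ n (inverse σ) D₁ ∧ delASubᵇ n (inverse σ) D₂

covered : ℕ → List ℕ → List ℕ → List ℕ → Bool
covered n D₁ D₂ π = desSSubᵇ (inverse π) D₁ ∧ delCovered n (inverse π) D₂

aIndexed-cover : ∀ {n σ} D₁ D₂ → 0 < n → IsEvenPerm (suc n) σ → aIndexed n D₁ D₂ σ ≡ covered n D₁ D₂ (cover σ)
aIndexed-cover {n} {σ} D₁ D₂ 0<n ev = trans
  (cong₂ _∧_ (desASubᵇ-cover 0<n (inverse-even ev) D₁)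
    (delCovered-cong {D = D₂} (isDelA (inverse σ)) (cover (inverse σ)) (isDelA-cover (inverse-perm (proj₁ ev)))))
  (cong (λ π → desSSubᵇ π D₁ ∧ delCovered n π D₂) (sym (cover-inverse (proj₁ ev))))

covered-foata : ∀ {n π} D₁ D₂ → IsPerm n π → covered n D₁ D₂ (foata π) ≡ covered n D₁ D₂ π
covered-foata {n} {π} D₁ D₂ r = cong₂ _∧_
  (desSSubᵇ-cong {u = inverse (foata π)} {inverse π} D₁ (perm-length (inverse-perm (foata-perm r))) (perm-length (inverse-perm r)) (isDesS-inverse-foata r))
  (delCovered-cong {D = D₂} (λ i → isDelS (inverse (foata π)) (i ∸ 1)) (inverse π) (isDelS-inverse-foata r))

-- Equidistribution on the alternating group

count-∧-split : (p q : A → Bool) (xs : List A) → count (λ x → p x ∧ q x) xs + count (λ x → not (p x) ∧ q x) xs ≡ count q xs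
count-∧-split p q []       = refl
count-∧-split p q (x ∷ xs) with p x | q x
... | true  | true  = cong suc (count-∧-split p q xs)
... | true  | false = count-∧-split p q xs
... | false | true  = trans (+-suc _ _) (cong suc (count-∧-split p q xs))
... | false | false = count-∧-split p q xs

cover-exchange-0 : ∀ v → cover (exchange 0 v) ≡ cover v
cover-exchange-0 v = cong (map pred) (shedHead-exchange-0 v)

isEven : List ℕ → Bool
isEven σ = lenS σ % 2 ≡ᵇ 0

isEven-exchange-0 : ∀ {n σ} → 0 < n → IsPerm (suc n) σ → isEven (exchange 0 σ) ≡ not (isEven σ)
isEven-exchange-0 {n} {σ} 0<n r = trans (isEven-inv (exchange 0 σ))
  (trans (even-inv-exchange 0 σ (perm-unique r) (subst (1 <_) (sym (perm-length r)) (s≤s 0<n))) (cong not (sym (isEven-inv σ))))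
  where
  isEven-inv : ∀ σ → isEven σ ≡ even (inv σ)
  isEven-inv σ = trans (even-% (lenS σ)) (cong even (lenS≡inv σ))

-- σ ↦ σ s₁ preserves cover σ and reverses the parity.
count-Alt-twice : ∀ {n} → 0 < n → (q : List ℕ → Bool) →
  count (q ∘ cover) (Alt (suc n)) + count (q ∘ cover) (Alt (suc n)) ≡ count (q ∘ cover) (Sym (suc n))
count-Alt-twice {n} 0<n q = begin
  count (q ∘ cover) (Alt (suc n)) + count (q ∘ cover) (Alt (suc n))
    ≡⟨ cong₂ _+_ (count-filter (q ∘ cover) isEven (Sym (suc n))) (trans (count-filter (q ∘ cover) isEven (Sym (suc n))) flip) ⟩
  count (λ σ → isEven σ ∧ q (cover σ)) (Sym (suc n)) + count (λ σ → not (isEven σ) ∧ q (cover σ)) (Sym (suc n))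
    ≡⟨ count-∧-split isEven (q ∘ cover) (Sym (suc n)) ⟩
  count (q ∘ cover) (Sym (suc n)) ∎
  where
  open ≡-Reasoning
  flip : count (λ σ → isEven σ ∧ q (cover σ)) (Sym (suc n)) ≡ count (λ σ → not (isEven σ) ∧ q (cover σ)) (Sym (suc n))
  flip = trans (sym (count-injective (unique-Sym (suc n)) (λ σ∈ → ∈-Sym⁺ (exchange-perm 0 (∈-Sym⁻ {suc n} σ∈)))
      (λ {σ} {τ} _ _ e → trans (sym (exchange-involutive 0 σ)) (trans (cong (exchange 0) e) (exchange-involutive 0 τ)))
      (λ σ → isEven σ ∧ q (cover σ))))
    (count-cong (Sym (suc n)) λ {σ} σ∈ → cong₂ _∧_ (isEven-exchange-0 0<n (∈-Sym⁻ {suc n} σ∈)) (cong q (cover-exchange-0 σ)))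

double-injective : ∀ {m n} → m + m ≡ n + n → m ≡ n
double-injective {m} {n} e = trans (n≡⌊n+n/2⌋ m) (trans (cong ⌊_/2⌋ e) (sym (n≡⌊n+n/2⌋ n)))

rmajA-lenA-equidistributed : ∀ n D₁ D₂ k → 0 < n → coeff (AIndex n D₁ D₂) (rmajA n) k ≡ coeff (AIndex n D₁ D₂) (lenA n) k
rmajA-lenA-equidistributed n D₁ D₂ k 0<n = begin
  coeff (AIndex n D₁ D₂) (rmajA n) k
    ≡⟨ descend rmajS (rmajA n) (rmajA-cover 0<n) ⟩
  count (with-stat rmajS ∘ cover) (Alt (suc n))
    -- The lift may leave A_{n+1}, so the comparison is made between the doubled counts, which are
    -- counts over S_{n+1}.
    ≡⟨ double-injective (trans (count-Alt-twice 0<n (with-stat rmajS)) (trans on-Sym (sym (count-Alt-twice 0<n (with-stat lenS))))) ⟩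
  count (with-stat lenS ∘ cover) (Alt (suc n))
    ≡⟨ descend lenS (lenA n) (lenA-cover 0<n) ⟨
  coeff (AIndex n D₁ D₂) (lenA n) k ∎
  where
  open ≡-Reasoning
  with-stat : (List ℕ → ℕ) → List ℕ → Bool
  with-stat f π = covered n D₁ D₂ π ∧ (f π ≡ᵇ k)
  descend : ∀ f g → (∀ {σ} → IsEvenPerm (suc n) σ → g σ ≡ f (cover σ)) →
    coeff (AIndex n D₁ D₂) g k ≡ count (with-stat f ∘ cover) (Alt (suc n))
  descend f g h = trans (count-filter (λ σ → g σ ≡ᵇ k) (aIndexed n D₁ D₂) (Alt (suc n)))
    (count-cong (Alt (suc n)) λ σ∈ → cong₂ (λ b l → b ∧ (l ≡ᵇ k)) (aIndexed-cover D₁ D₂ 0<n (∈-Alt⁻ σ∈)) (h (∈-Alt⁻ σ∈)))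
  on-Sym : count (with-stat rmajS ∘ cover) (Sym (suc n)) ≡ count (with-stat lenS ∘ cover) (Sym (suc n))
  on-Sym = trans (count-cong (Sym (suc n)) λ {σ} σ∈ → let r = ∈-Sym⁻ {suc n} σ∈ in
      trans (cong₂ (λ b l → b ∧ (l ≡ᵇ k)) (sym (covered-foata D₁ D₂ (cover-perm r))) (sym (lenS-foata (cover σ))))
        (cong (with-stat lenS) (sym (cover-lift r))))
    (count-injective (unique-Sym (suc n)) (λ {σ} σ∈ → let r = ∈-Sym⁻ {suc n} σ∈ in ∈-Sym⁺ (perm-resp-↭ (lift-↭ σ (perm-unique r)) r))
      (λ {σ} {τ} σ∈ τ∈ → lift-injective σ τ (perm-unique (∈-Sym⁻ {suc n} σ∈)) (perm-unique (∈-Sym⁻ {suc n} τ∈)))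
      (with-stat lenS ∘ cover))

theorem9p1 : (n : ℕ) → 1 ≤ n → (D₁ D₂ : List ℕ) → SubsetOf D₁ (n ∸ 1) → SubsetOf D₂ (n ∸ 1) →
    ((k : ℕ) → coeff (SIndex n D₁ D₂) rmajS k ≡ coeff (SIndex n D₁ D₂) lenS k)
    × ((k : ℕ) → coeff (AIndex n D₁ D₂) (rmajA n) k ≡ coeff (AIndex n D₁ D₂) (lenA n) k)
theorem9p1 n 1≤n D₁ D₂ _ _ = rmajS-lenS-equidistributed n D₁ D₂ , λ k → rmajA-lenA-equidistributed n D₁ D₂ k 1≤n
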